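{- Let $G$ be any connected chordal graph, let $\mathcal T$ be the set of clique trees of $G$, let $\varPi$ be the set of perfect sequences of the maximal cliques of $G$, and let $\mathcal R\subseteq\mathcal T\times\varPi$ be the relation "$T$ can be generated from $\pi$" defined in the context. Then the bipartite graph $B=(\mathcal T\cup\varPi,\mathcal R)$, with vertex classes $\mathcal T$ and $\varPi$ and an edge between $T$ and $\pi$ exactly when $(T,\pi)\in\mathcal R$, is connected.
   Context: Graphs are finite, simple and undirected. Maximal cliques are regarded as subsets of the vertex set; $\mathcal C=\{C_1,\dots,C_K\}$ is the set of all maximal cliques of $G$. A clique tree of $G$ is a tree $T=(\mathcal C,\mathcal E)$ with node set $\mathcal C$ such that for all $C_1,C_2\in\mathcal C$ and every $C_3\in\mathcal C$ on the unique path in $T$ between $C_1$ and $C_2$, $C_1\cap C_2\subseteq C_3$. For a permutation $\pi$ of $\{1,\dots,K\}$ put $S_{\pi(k)}=(C_{\pi(1)}\cup\cdots\cup C_{\pi(k-1)})\cap C_{\pi(k)}$ for $k=2,\dots,K$. The sequence $C_{\pi(1)},\dots,C_{\pi(K)}$ (identified with $\pi$) is a perfect sequence if for all $k\ge2$ the set $S_{\pi(k)}$ is a clique and there exists $k'<k$ with $S_{\pi(k)}\subset C_{\pi(k')}$. Given $\pi\in\varPi$, a tree with node set $\mathcal C$ is generated from $\pi$ as follows: start with no edges; for each $k=2,\dots,K$ choose any $k'<k$ with $S_{\pi(k)}=C_{\pi(k')}\cap C_{\pi(k)}$ and add the edge $(C_{\pi(k)},C_{\pi(k')})$. Every tree obtained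 this way is a clique tree. Define $(T,\pi)\in\mathcal R$ if $T$ can be generated from $\pi$ by this procedure for some sequence of choices. -}

module Defs where

open import Data.Empty using (⊥)
open import Data.Fin.Base using (Fin; toℕ; _<_)
open import Data.Fin.Permutation using (Permutation′; _⟨$⟩ʳ_)
open import Data.Fin.Properties using (_<?_)
open import Data.Fin.Subset using (Subset; _∈_; _⊆_; _∩_; ⋃)
open import Data.List.Base using (List; []; _∷_; map; filter; allFin)
import Data.List.Membership.Propositional as List
open import Data.List.Relation.Unary.Unique.Propositional using (Unique)
open import Data.Nat.Base as ℕ using (ℕ; suc)
open import Data.Product.Base using (Σ-syntax; ∃-syntax; _×_)
open import Data.Sum.Base using (_⊎_; inj₁; inj₂)
open import Function.Bundles using (_⇔_)
open import Function.Definitions using (Injective)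
open import Level using (Level; 0ℓ)
open import Relation.Binary.Construct.Closure.ReflexiveTransitive
  using (Star; ε; _◅_)
open import Relation.Binary.Core using (Rel)
open import Relation.Binary.Definitions
  using (Symmetric; Irreflexive; Decidable)
open import Relation.Binary.PropositionalEquality.Core using (_≡_; _≢_)
open import Relation.Nullary.Negation.Core using (¬_)

private
  variable
    a ℓ : Level
    A : Set a
    n : ℕ

-- Finite simple undirected graphs on the vertex set Fin n.  Decidability
-- records that the edge set is a finite set and is classically automatic.
record Graph (n : ℕ) : Set₁ where
  field
    Adj    : Rel (Fin n) 0ℓ
    sym    : Symmetric Adj
    irrefl : Irreflexive _≡_ Adj
    adj?   : Decidable Adj

open Graph public using (Adj)

-- Stated for a bare symmetric adjacency relation so that it applies both to a
-- Graph and to the bipartite graph below.  As usual, a connected graph has at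
-- least one vertex.
Connected : {A : Set a} → Rel A ℓ → Set _
Connected {A = A} R = A × (∀ x y → Star R x y)

vertices : {R : Rel A ℓ} {x y : A} → Star R x y → List A
vertices {x = x} ε       = x ∷ []
vertices {x = x} (_ ◅ w) = x ∷ vertices w

IsPath : {R : Rel A ℓ} {x y : A} → Star R x y → Set _
IsPath w = Unique (vertices w)

-- j is the cyclic successor of i in 0, 1, …, m − 1.
Next : {m : ℕ} → Fin m → Fin m → Set
Next {m} i j =
  toℕ j ≡ suc (toℕ i) ⊎ (suc (toℕ i) ≡ m × toℕ j ≡ 0)

-- A cycle of the graph in the usual sense only when m ≥ 3.
record Cycle (G : Graph n) (m : ℕ) : Set where
  field
    vertex    : Fin m → Fin n
    injective : Injective _≡_ _≡_ vertex
    edge      : ∀ {i j} → Next i j → Adj G (vertex i) (vertex j)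

Chord : {G : Graph n} {m : ℕ} → Cycle G m → Set
Chord {G = G} {m} c = ∃[ i ] ∃[ j ]
  ¬ Next {m} i j × ¬ Next j i × Adj G (vertex i) (vertex j)
  where open Cycle c

Chordal : Graph n → Set
Chordal G = ∀ {m} → 4 ℕ.≤ m → (c : Cycle G m) → Chord c

Acyclic : Graph n → Set
Acyclic G = ∀ {m} → 3 ℕ.≤ m → ¬ Cycle G m

IsTree : Graph n → Set
IsTree T = Connected (Adj T) × Acyclic T

IsClique : Graph n → Subset n → Set
IsClique G S = ∀ {u v} → u ∈ S → v ∈ S → u ≢ v → Adj G u v

IsMaximalClique : Graph n → Subset n → Set
IsMaximalClique G S = IsClique G S × (∀ S′ → IsClique G S′ → S ⊆ S′ → S′ ⊆ S)

-- An enumeration C₁, …, C_K, without repetition, of all maximal cliques.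
record MaximalCliques (G : Graph n) : Set where
  field
    K         : ℕ
    C         : Fin K → Subset n
    injective : Injective _≡_ _≡_ C
    maximal   : ∀ i → IsMaximalClique G (C i)
    complete  : ∀ S → IsMaximalClique G S → ∃[ i ] C i ≡ S

module _ {G : Graph n} (𝒞 : MaximalCliques G) where
  open MaximalCliques 𝒞

  -- Trees with node set 𝒞 are graphs on the index set Fin K.
  record CliqueTree : Set₁ where
    field
      tree     : Graph K
      isTree   : IsTree tree
      junction : ∀ {i j} (p : Star (Adj tree) i j) → IsPath p →
                 ∀ {k} → k List.∈ vertices p → C i ∩ C j ⊆ C k

  -- Positions are numbered from 0, so "k ≥ 2" reads 0 < toℕ k.
  separator : Permutation′ K → Fin K → Subset n
  separator π k =
    ⋃ (map (λ j → C (π ⟨$⟩ʳ j)) (filter (_<? k) (allFin K))) ∩ C (π ⟨$⟩ʳ k)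

  IsPerfect : Permutation′ K → Set
  IsPerfect π = ∀ k → 0 ℕ.< toℕ k →
    IsClique G (separator π k) ×
    (∃[ k′ ] k′ < k × separator π k ⊆ C (π ⟨$⟩ʳ k′))

  record PerfectSequence : Set where
    field
      perm    : Permutation′ K
      perfect : IsPerfect perm

  -- The choices k ↦ k′ are collected in one function, whose value at the
  -- initial position is irrelevant; the edges of T are exactly those added.
  Generates : PerfectSequence → CliqueTree → Set
  Generates Π T = Σ[ choice ∈ (Fin K → Fin K) ]
    (∀ k → 0 ℕ.< toℕ k →
       choice k < k × separator π k ≡ C (π ⟨$⟩ʳ choice k) ∩ C (π ⟨$⟩ʳ k)) ×
    (∀ i j → Adj (CliqueTree.tree T) i j ⇔
       (∃[ k ] 0 ℕ.< toℕ k ×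
         ((i ≡ π ⟨$⟩ʳ k × j ≡ π ⟨$⟩ʳ choice k) ⊎
          (i ≡ π ⟨$⟩ʳ choice k × j ≡ π ⟨$⟩ʳ k))))
    where π = PerfectSequence.perm Π

  -- Vertices are representatives: two trees with the same edges, or two
  -- permutations with the same values, have the same neighbours here, so
  -- connectedness does not depend on whether they are identified.
  BipartiteAdj : Rel (CliqueTree ⊎ PerfectSequence) 0ℓ
  BipartiteAdj (inj₁ T) (inj₂ Π) = Generates Π T
  BipartiteAdj (inj₂ Π) (inj₁ T) = Generates Π T
  BipartiteAdj (inj₁ _) (inj₁ _) = ⊥
  BipartiteAdj (inj₂ _) (inj₂ _) = ⊥

{-# OPTIONS --safe #-}
-- Every perfect sequence generates a clique tree, and every clique tree T is
-- generated by a search order of T from any of its cliques, so it suffices to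
-- connect two clique trees T and T′ by exchanges of edges.  If ab is an edge of
-- T′ but not of T, the path from a to b in T crosses the cut T′ − ab at an edge
-- cd; by the junction properties C_c ∩ C_d = C_a ∩ C_b, and T can be changed from
-- cd to ad and then from ad to ab without losing any edge of T′.  Two clique trees
-- differing in edges cb and ab with a common end b are generated by one and the
-- same perfect sequence, a search order from a: only the choice at b differs.
--
-- A clique tree exists because a chordal graph is built by adding simplicial
-- vertices (Dirac); such a vertex enlarges one clique of the family or adds a
-- new last one, and both preserve the running intersection property.
module Submission where

open import Defs
open import Data.Bool.Base using (true)
import Data.Bool.Properties as Bool
open import Data.Empty using (⊥-elim)
open import Data.Fin.Base as Fin
  using (Fin; toℕ; zero; suc; fromℕ; fromℕ<; inject₁; opposite)
open import Data.Fin.Induction using (<-wellFounded)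
open import Data.Fin.Permutation as Perm using (Permutation′; _⟨$⟩ʳ_; _⟨$⟩ˡ_)
open import Data.Fin.Properties as Fin using (_≟_; toℕ-injective)
open import Data.Fin.Subset
  using (Subset; _∈_; _∉_; _⊆_; _∩_; _∪_; ⋃; ⁅_⁆) renaming (⊥ to ∅)
open import Data.Fin.Subset.Properties
  using (_∈?_; ∉⊥; x∈p∩q⁺; x∈p∩q⁻; x∈p∪q⁺; x∈p∪q⁻; ⊆-antisym; p∩q⊆p; p∩q⊆q; _⊆?_;
         x∈⁅x⁆; x∈⁅y⁆⇒x≡y)
open import Data.List.Base
  using (List; []; _∷_; _++_; length; lookup; map; filter; allFin; cartesianProduct)
import Data.List.Membership.Propositional as List
open import Data.List.Membership.Propositional.Properties
  using (∈-lookup; ∈-filter⁺; ∈-filter⁻; ∈-allFin; ∈-++⁺ˡ; ∈-++⁺ʳ;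
         ∈-cartesianProduct⁺; ∈-map⁺; ∈-map⁻)
open import Data.List.Properties using (filter-notAll; length-filter; length-tabulate)
open import Data.List.Relation.Unary.All as All using (All; []; _∷_)
open import Data.List.Relation.Unary.All.Properties using (¬Any⇒All¬; ++⁻ʳ)
open import Data.List.Relation.Unary.AllPairs using ([]; _∷_)
open import Data.List.Relation.Unary.Any as Any using (Any; here; there; any?)
import Data.List.Relation.Unary.Any.Properties as Any
open import Data.List.Relation.Unary.Unique.Propositional using (Unique)
open import Data.Nat.Base as ℕ using (ℕ; suc; s≤s; z≤n)
import Data.Nat.Properties as ℕ
open import Data.Product.Base using (Σ-syntax; ∃-syntax; _×_; _,_; proj₁; proj₂)
open import Data.Sum.Base as Sum using (_⊎_; inj₁; inj₂)
open import Data.Unit.Base using (⊤; tt)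
open import Data.Vec.Base using (tabulate)
open import Data.Vec.Properties using (≡-dec; lookup∘tabulate; lookup⇒[]=; []=⇒lookup)
open import Function.Base using (_∘_)
open import Function.Bundles using (mk⇔; Equivalence)
open import Function.Construct.Identity using (⇔-id)
open import Induction.WellFounded using (Acc; acc)
open import Level using (Level; 0ℓ)
open import Relation.Binary.Construct.Closure.ReflexiveTransitive
  using (Star; ε; _◅_; _◅◅_)
open import Relation.Binary.Definitions using (tri<; tri≈; tri>)
open import Relation.Binary.PropositionalEquality
open import Relation.Nullary
open import Relation.Nullary.Decidable using (¬?; dec-true; decidable-stable)
open import Relation.Unary using (Pred; Decidable)

private
  variable
    a : Level
    A : Set a

-- Lists without repetition

lookup-injective : {xs : List A} → Unique xs → (i j : Fin (length xs)) →
                   lookup xs i ≡ lookup xs j → i ≡ j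
lookup-injective (_ ∷ _)   zero    zero    _ = refl
lookup-injective (x∉ ∷ _)  zero    (suc j) p = contradiction p (All.lookup x∉ (∈-lookup j))
lookup-injective (x∉ ∷ _)  (suc i) zero    p = contradiction (sym p) (All.lookup x∉ (∈-lookup i))
lookup-injective (_ ∷ u)   (suc i) (suc j) p = cong suc (lookup-injective u i j p)

++-apart : ∀ (xs : List A) {ys x y} → Unique (xs ++ ys) → x List.∈ xs → y List.∈ ys → x ≢ y
++-apart (_ ∷ xs) (x∉ ∷ _) (here refl) y∈ = All.lookup (++⁻ʳ xs x∉) y∈
++-apart (_ ∷ xs) (_ ∷ u)  (there x∈)  y∈ = ++-apart xs u x∈ y∈

-- Walks, paths and cycles

module Walks {n : ℕ} (G : Graph n) where
  open Graph G using (adj?; irrefl) renaming (sym to adj-sym)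

  private
    variable
      Q Q′ : Pred (Fin n) 0ℓ
      u v x y z : Fin n

  Walk : Fin n → Fin n → Set
  Walk = Star (Adj G)

  WalkIn : Pred (Fin n) 0ℓ → Fin n → Fin n → Set
  WalkIn Q x y = Σ[ w ∈ Walk x y ] All Q (vertices w)

  start : (w : Walk x y) → All Q (vertices w) → Q x
  start ε       (q ∷ _) = q
  start (_ ◅ _) (q ∷ _) = q

  end : (w : Walk x y) → All Q (vertices w) → Q y
  end ε       (q ∷ _)  = q
  end (_ ◅ w) (_ ∷ qs) = end w qs

  start∈ : (w : Walk x y) → x List.∈ vertices w
  start∈ ε       = here refl
  start∈ (_ ◅ _) = here refl

  end∈ : (w : Walk x y) → y List.∈ vertices w
  end∈ ε       = here refl
  end∈ (_ ◅ w) = there (end∈ w)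

  _++ʷ_ : WalkIn Q x y → WalkIn Q y z → WalkIn Q x z
  (v , qs) ++ʷ (w , rs) = v ◅◅ w , all v qs
    where
    all : ∀ {x} (v : Walk x _) → All _ (vertices v) → All _ (vertices (v ◅◅ w))
    all ε       _        = rs
    all (_ ◅ v) (q ∷ qs) = q ∷ all v qs

  reverseʷ : (w : Walk x y) → All Q (vertices w) → WalkIn Q y x
  reverseʷ ε       qs       = ε , qs
  reverseʷ (e ◅ w) (q ∷ qs) =
    reverseʷ w qs ++ʷ (adj-sym e ◅ ε , start w qs ∷ q ∷ [])

  weaken : (∀ {x} → Q x → Q′ x) → WalkIn Q x y → WalkIn Q′ x y
  weaken f (w , qs) = w , All.map f qs

  later : Walk x y → List (Fin n)
  later ε       = []
  later (_ ◅ w) = vertices w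

  -- `later w` leaves out the successor of `x`, so only edges to vertices two or more steps ahead
  -- are excluded; together with `IsPath` this describes an induced path.
  Chordless : Walk x y → Set
  Chordless ε               = ⊤
  Chordless {x = x} (_ ◅ w) = All (λ z → ¬ Adj G x z) (later w) × Chordless w

  record Path (Q : Pred (Fin n) 0ℓ) (x y : Fin n) : Set where
    constructor path
    field
      walk      : Walk x y
      isPath    : IsPath walk
      chordless : Chordless walk
      inside    : All Q (vertices walk)

  suffix : (w : Walk x y) → IsPath w → Chordless w → All Q (vertices w) →
           z List.∈ vertices w → Path Q z y
  suffix ε       u       c       q       (here refl) = path ε u c q
  suffix (e ◅ w) u       c       q       (here refl) = path (e ◅ w) u c q
  suffix (_ ◅ w) (_ ∷ u) (_ , c) (_ ∷ q) (there z∈w) = suffix w u c q z∈w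

  -- The new edge leads to the last neighbour of x, so it creates no chord.
  attach : Q x → (w : Walk z y) → IsPath w → Chordless w → All Q (vertices w) →
           All (x ≢_) (vertices w) → Any (Adj G x) (vertices w) → Path Q x y
  attach qx ε u c q x∉ (here e) = path (e ◅ ε) (x∉ ∷ u) ([] , c) (qx ∷ q)
  attach {x = x} qx (f ◅ w) (z∉ ∷ u) (z↛ , c) (qz ∷ q) (x≢z ∷ x∉) a
    with any? (adj? x) (vertices w)
  ... | yes b = attach qx w u c q x∉ b
  ... | no ¬b with a
  ...   | there b = contradiction b ¬b
  ...   | here e  = path (e ◅ f ◅ w) ((x≢z ∷ x∉) ∷ z∉ ∷ u)
                         (¬Any⇒All¬ _ ¬b , z↛ , c) (qx ∷ qz ∷ q)

  -- Induction on the walk: if `x` recurs on the shortened rest, the path restarts at that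
  -- occurrence; otherwise `x` is attached in front. Only vertices of the walk are used, so `Q` is
  -- inherited.
  chordlessPath : (w : Walk x y) → All Q (vertices w) → Path Q x y
  chordlessPath ε q = path ε ([] ∷ []) tt q
  chordlessPath {x = x} (e ◅ w) (qx ∷ q) with chordlessPath w q
  ... | path p u c r with any? (x ≟_) (vertices p)
  ...   | yes x∈p = suffix p u c r x∈p
  ...   | no  x∉p = attach qx p u c r (¬Any⇒All¬ _ x∉p)
                      (Any.map (λ { refl → e }) (start∈ p))

  lookup-start : (w : Walk x y) (i : Fin (length (vertices w))) → toℕ i ≡ 0 →
                 lookup (vertices w) i ≡ x
  lookup-start ε       zero _ = refl
  lookup-start (_ ◅ _) zero _ = refl

  lookup-end : (w : Walk x y) (i : Fin (length (vertices w))) →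
               suc (toℕ i) ≡ length (vertices w) → lookup (vertices w) i ≡ y
  lookup-end ε         zero    _ = refl
  lookup-end (_ ◅ ε)   (suc zero) _ = refl
  lookup-end (_ ◅ w@(_ ◅ _)) (suc i) p = lookup-end w i (ℕ.suc-injective p)

  end-index : (w : Walk x y) → Σ[ i ∈ Fin (length (vertices w)) ] suc (toℕ i) ≡ length (vertices w)
  end-index ε       = zero , refl
  end-index (_ ◅ w) with end-index w
  ... | i , p = suc i , cong suc p

  start-index : (w : Walk x y) → Σ[ i ∈ Fin (length (vertices w)) ] toℕ i ≡ 0
  start-index ε       = zero , refl
  start-index (_ ◅ _) = zero , refl

  lookup-step : (w : Walk x y) (i j : Fin (length (vertices w))) →
                toℕ j ≡ suc (toℕ i) →
                Adj G (lookup (vertices w) i) (lookup (vertices w) j)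
  lookup-step ε       zero    zero    ()
  lookup-step (e ◅ w) zero    (suc j) p
    rewrite lookup-start w j (ℕ.suc-injective p) = e
  lookup-step (_ ◅ w) (suc i) (suc j) p = lookup-step w i j (ℕ.suc-injective p)

  closeCycle : (p : Walk z v) → Unique (u ∷ vertices p) →
               Adj G u z → Adj G v u → Cycle G (suc (length (vertices p)))
  closeCycle {u = u} p unique uz vu = record
    { vertex    = lookup (u ∷ vertices p)
    ; injective = lookup-injective unique _ _
    ; edge      = edge
    }
    where
    w = uz ◅ p
    edge : ∀ {i j} → Next i j →
           Adj G (lookup (vertices w) i) (lookup (vertices w) j)
    edge {i} {j} (inj₁ p) = lookup-step w i j p
    edge {i} {j} (inj₂ (p , q))
      rewrite lookup-end w i p | lookup-start w j q = vu

  chordless-lookup : (w : Walk x y) → Chordless w →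
                     (i j : Fin (length (vertices w))) →
                     Adj G (lookup (vertices w) i) (lookup (vertices w) j) →
                     toℕ j ≡ suc (toℕ i) ⊎ toℕ i ≡ suc (toℕ j)
  chordless-lookup ε _ zero zero a = contradiction a (irrefl refl)
  chordless-lookup (_ ◅ _) _ zero zero a = contradiction a (irrefl refl)
  chordless-lookup (_ ◅ w) (x↛ , _) zero (suc j) a = inj₁ (cong suc (first w x↛ j a))
    where
    first : (w : Walk z y) → All (λ v → ¬ Adj G x v) (later w) →
            (j : Fin (length (vertices w))) → Adj G x (lookup (vertices w) j) → toℕ j ≡ 0
    first ε       _  zero    _ = refl
    first (_ ◅ w) _  zero    _ = refl
    first (_ ◅ w) x↛ (suc j) a = contradiction a (All.lookup x↛ (∈-lookup j))
  chordless-lookup (e ◅ w) c (suc i) zero a =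
    Sum.swap (chordless-lookup (e ◅ w) c zero (suc i) (adj-sym a))
  chordless-lookup (_ ◅ w) (_ , c) (suc i) (suc j) a =
    Sum.map (cong suc) (cong suc) (chordless-lookup w c i j a)

  -- A chord between two vertices of `p` contradicts its chordlessness; a chord at `u` ends, by
  -- `only`, at the first or last vertex of `p`, and these are the cyclic neighbours of `u`.
  closeCycle-chordless :
    (p : Walk z v) (unique : Unique (u ∷ vertices p)) → Chordless p →
    (uz : Adj G u z) (vu : Adj G v u) →
    (∀ {x} → x List.∈ vertices p → Adj G u x → x ≡ z ⊎ x ≡ v) →
    ¬ Chord (closeCycle p unique uz vu)
  closeCycle-chordless {u = u} p (u∉ ∷ unique) c uz vu only (i , j , ij , ji , a) =
    go i j ij ji a
    where
    vs = u ∷ vertices p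
    Ends : Fin (length (vertices p)) → Set
    Ends j = toℕ j ≡ 0 ⊎ suc (toℕ j) ≡ length (vertices p)
    ends : ∀ j → Adj G u (lookup (vertices p) j) → Ends j
    ends j a with only (∈-lookup j) a | start-index p | end-index p
    ... | inj₁ q | k , k≡0 | _ = inj₁ (trans
      (cong toℕ (lookup-injective unique j k (trans q (sym (lookup-start p k k≡0))))) k≡0)
    ... | inj₂ q | _ | k , k≡m = inj₂ (trans
      (cong (λ i → suc (toℕ i)) (lookup-injective unique j k (trans q (sym (lookup-end p k k≡m))))) k≡m)
    spoke : ∀ j → ¬ Next {length vs} zero (suc j) → ¬ Next {length vs} (suc j) zero →
            ¬ Adj G u (lookup (vertices p) j)
    spoke j ij ji a with ends j a
    ... | inj₁ q = ij (inj₁ (cong suc q))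
    ... | inj₂ q = ji (inj₂ (cong suc q , refl))
    go : ∀ i j → ¬ Next {length vs} i j → ¬ Next {length vs} j i →
         ¬ Adj G (lookup vs i) (lookup vs j)
    go zero    zero    _  _  a = irrefl refl a
    go zero    (suc j) ij ji a = spoke j ij ji a
    go (suc i) zero    ij ji a = spoke i ji ij (adj-sym a)
    go (suc i) (suc j) ij ji a with chordless-lookup p c i j a
    ... | inj₁ q = ij (inj₁ (cong suc q))
    ... | inj₂ q = ji (inj₁ (cong suc q))

  private
    nonTrivial : z ≢ v → (p : Walk z v) → 2 ℕ.≤ length (vertices p)
    nonTrivial z≢v ε             = contradiction refl z≢v
    nonTrivial z≢v (_ ◅ ε)       = s≤s (s≤s z≤n)
    nonTrivial z≢v (_ ◅ (_ ◅ _)) = s≤s (s≤s z≤n)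

  -- The walk shortens to a path avoiding `u`, and `u` closes it to a cycle. As `z ≢ v`, the path
  -- has at least two vertices and the cycle at least three.
  noDetour : Acyclic G → Adj G u v → Adj G u z → z ≢ v → ¬ WalkIn (u ≢_) z v
  noDetour acyclic uv uz z≢v (w , u∉) with chordlessPath w u∉
  ... | path p unique _ u∉p =
    acyclic (s≤s (nonTrivial z≢v p)) (closeCycle p (u∉p ∷ unique) uz (adj-sym uv))

  -- Where the two paths first diverge, their tails together join two neighbours of one vertex
  -- without meeting it, which `noDetour` forbids.
  path-unique : Acyclic G → (p q : Walk x y) → IsPath p → IsPath q →
                vertices p ≡ vertices q
  path-unique _ ε ε _ _ = refl
  path-unique _ ε (_ ◅ q) _ (x∉ ∷ _) = contradiction refl (end q x∉)
  path-unique _ (_ ◅ p) ε (x∉ ∷ _) _ = contradiction refl (end p x∉)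
  path-unique {x = x} acyclic (_◅_ {j = a} xa p) (_◅_ {j = b} xb q) (x∉p ∷ up) (x∉q ∷ uq)
    with b ≟ a
  ... | yes refl = cong (x ∷_) (path-unique acyclic p q up uq)
  ... | no b≢a = contradiction ((q , x∉q) ++ʷ reverseʷ p x∉p)
                               (noDetour acyclic xa xb b≢a)

  -- A walk inside `Q` shortens to a path inside `Q`, and by uniqueness that path is `p`. Junction
  -- properties thus follow from exhibiting any walk.
  path-within : Acyclic G → (p : Walk x y) → IsPath p → WalkIn Q x y → All Q (vertices p)
  path-within {Q = Q} acyclic p up (w , qs) with chordlessPath w qs
  ... | path r ur _ rs = subst (All Q) (path-unique acyclic r p ur up) rs

  record Crossing (P : Pred (Fin n) 0ℓ) {x y} (w : Walk x y) : Set where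
    constructor crossing
    field
      {from to} : Fin n
      before    : Walk x from
      step      : Adj G from to
      after     : Walk to y
      from∈     : P from
      to∉       : ¬ P to
      split     : vertices w ≡ vertices before ++ vertices after

  cross : {P : Pred (Fin n) 0ℓ} → Decidable P → (w : Walk x y) → P x → ¬ P y → Crossing P w
  cross P? ε px ¬py = contradiction px ¬py
  cross {x = x} P? (_◅_ {j = z} e w) px ¬py with P? z
  ... | no ¬pz = crossing ε e w px ¬pz refl
  ... | yes pz with cross P? w pz ¬py
  ...   | crossing before step after f∈ t∉ split =
    crossing (e ◅ before) step after f∈ t∉ (cong (x ∷_) split)

-- Trees generated by perfect sequences

argmax : ∀ {m} (f : Fin (suc m) → ℕ) → ∃[ t ] (∀ i → f i ℕ.≤ f t)
argmax {ℕ.zero} f = zero , λ { zero → ℕ.≤-refl }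
argmax {suc m} f with argmax (f ∘ suc)
... | t , max with ℕ.≤-total (f zero) (f (suc t))
...   | inj₁ p = suc t , λ { zero → p ; (suc i) → max i }
...   | inj₂ p = zero , λ { zero → ℕ.≤-refl ; (suc i) → ℕ.≤-trans (max i) p }

cyclicSucc : ∀ {m} (i : Fin m) → ∃[ j ] Next i j
cyclicSucc {suc m} i with suc (toℕ i) ℕ.<? suc m
... | yes p = fromℕ< p , inj₁ (Fin.toℕ-fromℕ< p)
... | no ¬p = zero , inj₂ (ℕ.≤-antisym (Fin.toℕ<n i) (ℕ.≮⇒≥ ¬p) , refl)

cyclicPred : ∀ {m} (j : Fin m) → ∃[ i ] Next i j
cyclicPred {suc m} zero    = fromℕ m , inj₂ (cong suc (Fin.toℕ-fromℕ m) , refl)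
cyclicPred {suc m} (suc j) = inject₁ j , inj₁ (cong suc (sym (Fin.toℕ-inject₁ j)))

-- A step forward and a wrap-around force length 2, two wrap-arounds force length 1. The lemma makes
-- the two neighbours of a vertex on a cycle distinct.
Next-asym : ∀ {m} → 3 ℕ.≤ m → {i j : Fin m} → Next i j → ¬ Next j i
Next-asym _ {i} (inj₁ p) (inj₁ q) = ℕ.m≢1+n+m (toℕ i) {1} (trans q (cong suc p))
Next-asym 3≤m (inj₁ p) (inj₂ (q , r)) rewrite p | r | sym q with 3≤m
... | s≤s (s≤s ())
Next-asym 3≤m (inj₂ (q , r)) (inj₁ p) rewrite p | r | sym q with 3≤m
... | s≤s (s≤s ())
Next-asym 3≤m (inj₂ (_ , r)) (inj₂ (p , _)) rewrite r | sym p with 3≤m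
... | s≤s ()

∈⋃⁺ : ∀ {n} {x : Fin n} {ps : List (Subset n)} → Any (x ∈_) ps → x ∈ ⋃ ps
∈⋃⁺ (here x∈p)  = x∈p∪q⁺ (inj₁ x∈p)
∈⋃⁺ (there any) = x∈p∪q⁺ (inj₂ (∈⋃⁺ any))

∈⋃⁻ : ∀ {n} {x : Fin n} (ps : List (Subset n)) → x ∈ ⋃ ps → Any (x ∈_) ps
∈⋃⁻ []       x∈ = contradiction x∈ ∉⊥
∈⋃⁻ (p ∷ ps) x∈ with x∈p∪q⁻ p (⋃ ps) x∈
... | inj₁ x∈p  = here x∈p
... | inj₂ x∈ps = there (∈⋃⁻ ps x∈ps)

0<⇐< : ∀ {K} {j k : Fin K} → j Fin.< k → 0 ℕ.< toℕ k
0<⇐< = ℕ.≤-<-trans z≤n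

firstIndex : ∀ {K} → Fin K → Σ[ r ∈ Fin K ] toℕ r ≡ 0
firstIndex zero    = zero , refl
firstIndex (suc _) = zero , refl

position : ∀ {K} (π : Permutation′ K) {x k} → x ≡ π ⟨$⟩ʳ k → π ⟨$⟩ˡ x ≡ k
position π p = trans (cong (π ⟨$⟩ˡ_) p) (Perm.inverseˡ π)

perm-injective : ∀ {K} (π : Permutation′ K) {j k} → π ⟨$⟩ʳ j ≡ π ⟨$⟩ʳ k → j ≡ k
perm-injective π p = trans (sym (Perm.inverseˡ π)) (position π p)

module Climbing {K : ℕ} (T : Graph K) (π : Permutation′ K) (choice : Fin K → Fin K)
  (up : ∀ k → 0 ℕ.< toℕ k → choice k Fin.< k × Adj T (π ⟨$⟩ʳ k) (π ⟨$⟩ʳ choice k))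
  where
  open Walks T

  UpTo : Fin K → Fin K → Set
  UpTo k x = ∃[ j ] j Fin.≤ k × π ⟨$⟩ʳ j ≡ x

  -- Choices decrease, so iterating them ends at position 0. `UpTo k` records that no position after
  -- `k` is met; this later lets walks avoid a given node.
  climb : ∀ {r} → toℕ r ≡ 0 → ∀ k → WalkIn (UpTo k) (π ⟨$⟩ʳ k) (π ⟨$⟩ʳ r)
  climb {r} r≡0 k = go k (<-wellFounded k)
    where
    go : ∀ k → Acc Fin._<_ k → WalkIn (UpTo k) (π ⟨$⟩ʳ k) (π ⟨$⟩ʳ r)
    go k (acc rs) with 0 ℕ.<? toℕ k
    ... | no ¬p with refl ← toℕ-injective {i = k} {r} (trans (ℕ.n≤0⇒n≡0 (ℕ.≮⇒≥ ¬p)) (sym r≡0)) =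
      ε , (k , ℕ.≤-refl , refl) ∷ []
    ... | yes p with up k p
    ...   | c<k , e = ((e ◅ ε) , (k , ℕ.≤-refl , refl) ∷ (choice k , ℕ.<⇒≤ c<k , refl) ∷ [])
      ++ʷ weaken (λ (j , j≤c , q) → j , ℕ.≤-trans j≤c (ℕ.<⇒≤ c<k) , q) (go (choice k) (rs c<k))

module _ {n : ℕ} {G : Graph n} (𝒞 : MaximalCliques G) where
  open MaximalCliques 𝒞 using (K; C)

  private
    variable
      v : Fin n

  ∈-separator⁺ : ∀ π {j k} → j Fin.< k → v ∈ C (π ⟨$⟩ʳ j) → v ∈ C (π ⟨$⟩ʳ k) →
                 v ∈ separator 𝒞 π k
  ∈-separator⁺ π {j} {k} j<k v∈j v∈k = x∈p∩q⁺
    (∈⋃⁺ (Any.map⁺ (List.lose (∈-filter⁺ (Fin._<? k) (∈-allFin j) j<k) v∈j)) , v∈k)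

  ∈-separator⁻ : ∀ π {k} → v ∈ separator 𝒞 π k →
                 (∃[ j ] j Fin.< k × v ∈ C (π ⟨$⟩ʳ j)) × v ∈ C (π ⟨$⟩ʳ k)
  ∈-separator⁻ π {k} v∈ with x∈p∩q⁻ _ _ v∈
  ... | v∈⋃ , v∈k with List.find (Any.map⁻ (∈⋃⁻ (map (λ j → C (π ⟨$⟩ʳ j)) (filter (Fin._<? k) (allFin K))) v∈⋃))
  ...   | j , j∈ , v∈j = (j , proj₂ (∈-filter⁻ (Fin._<? k) {xs = allFin K} j∈) , v∈j) , v∈k

  IsChoice : Permutation′ K → (Fin K → Fin K) → Set
  IsChoice π choice = ∀ k → 0 ℕ.< toℕ k →
    choice k Fin.< k × separator 𝒞 π k ≡ C (π ⟨$⟩ʳ choice k) ∩ C (π ⟨$⟩ʳ k)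

  module Generated (π : Permutation′ K) (choice : Fin K → Fin K)
                   (isChoice : IsChoice π choice) where

    Edge : Fin K → Fin K → Set
    Edge i j = ∃[ k ] 0 ℕ.< toℕ k ×
      ((i ≡ π ⟨$⟩ʳ k × j ≡ π ⟨$⟩ʳ choice k) ⊎ (i ≡ π ⟨$⟩ʳ choice k × j ≡ π ⟨$⟩ʳ k))

    private
      choice≢ : ∀ {k} → 0 ℕ.< toℕ k → π ⟨$⟩ʳ choice k ≢ π ⟨$⟩ʳ k
      choice≢ {k} p q = Fin.<-irrefl (perm-injective π q) (proj₁ (isChoice k p))

    graph : Graph K
    graph = record
      { Adj    = Edge
      ; sym    = λ (k , p , e) → k , p , Sum.map (λ (a , b) → b , a) (λ (a , b) → b , a) (Sum.swap e)
      ; irrefl = λ { refl (k , p , inj₁ (a , b)) → choice≢ p (trans (sym b) a)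
                   ; refl (k , p , inj₂ (a , b)) → choice≢ p (trans (sym a) b) }
      ; adj?   = λ i j → Fin.any? λ k → (0 ℕ.<? toℕ k) ×-dec
                   (((i ≟ π ⟨$⟩ʳ k) ×-dec (j ≟ π ⟨$⟩ʳ choice k)) ⊎-dec
                    ((i ≟ π ⟨$⟩ʳ choice k) ×-dec (j ≟ π ⟨$⟩ʳ k)))
      }

    open Walks graph
    open Climbing graph π choice
      (λ k p → proj₁ (isChoice k p) , k , p , inj₁ (refl , refl)) public

    -- Of the vertices of a cycle, the latest one in π would have two parents.
    acyclic : Acyclic graph
    acyclic {suc m} 3≤m c = Next-asym 3≤m q (subst (λ i → Next i t) (sym same) p)
      where
      open Cycle c
      pos : Fin (suc m) → Fin K
      pos i = π ⟨$⟩ˡ vertex i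
      t = proj₁ (argmax (toℕ ∘ pos))
      parent : ∀ i → Edge (vertex t) (vertex i) → vertex i ≡ π ⟨$⟩ʳ choice (pos t)
      parent i (k , 0<k , inj₁ (a , b)) =
        trans b (cong (λ k → π ⟨$⟩ʳ choice k) (sym (position π a)))
      parent i (k , 0<k , inj₂ (a , b)) = contradiction (proj₁ (isChoice k 0<k))
        (subst₂ (λ x y → ¬ (toℕ x ℕ.< toℕ y))
          (position π a)
          (position π b)
          (ℕ.≤⇒≯ (proj₂ (argmax (toℕ ∘ pos)) i)))
      i = proj₁ (cyclicPred t)
      j = proj₁ (cyclicSucc t)
      p : Next i t
      p = proj₂ (cyclicPred t)
      q : Next t j
      q = proj₂ (cyclicSucc t)
      same : j ≡ i
      same = injective (trans (parent j (edge q)) (sym (parent i (Graph.sym graph (edge p)))))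

    First : Fin n → Fin K → Set
    First v f = v ∈ C (π ⟨$⟩ʳ f) × (∀ j → j Fin.< f → v ∉ C (π ⟨$⟩ʳ j))

    -- If `v` also occurs before `k`, it belongs to the separator of `k` and hence to the chosen
    -- parent; the climb thus stays among cliques containing `v` until `v` has no earlier
    -- occurrence.
    climbToFirst : ∀ k → v ∈ C (π ⟨$⟩ʳ k) →
      ∃[ f ] First v f × WalkIn (λ x → v ∈ C x) (π ⟨$⟩ʳ k) (π ⟨$⟩ʳ f)
    climbToFirst {v} k = go k (<-wellFounded k)
      where
      go : ∀ k → Acc Fin._<_ k → v ∈ C (π ⟨$⟩ʳ k) →
        ∃[ f ] First v f × WalkIn (λ x → v ∈ C x) (π ⟨$⟩ʳ k) (π ⟨$⟩ʳ f)
      go k (acc rs) v∈k with Fin.any? (λ j → (j Fin.<? k) ×-dec (v ∈? C (π ⟨$⟩ʳ j)))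
      ... | no ¬p = k , (v∈k , λ j j<k v∈j → ¬p (j , j<k , v∈j)) , ε , v∈k ∷ []
      ... | yes (j , j<k , v∈j) with isChoice k (0<⇐< j<k)
      ...   | c<k , eq
        with go (choice k) (rs c<k) (proj₁ (x∈p∩q⁻ _ _ (subst (v ∈_) eq (∈-separator⁺ π j<k v∈j v∈k))))
      ...     | f , first , w , qs = f , first , (k , 0<⇐< j<k , inj₁ (refl , refl)) ◅ w , v∈k ∷ qs

    First-unique : ∀ {f g} → First v f → First v g → f ≡ g
    First-unique {f = f} {g} (v∈f , f-min) (v∈g , g-min) with Fin.<-cmp f g
    ... | tri< f<g _ _ = contradiction v∈f (g-min f f<g)
    ... | tri≈ _ f≡g _ = f≡g
    ... | tri> _ _ g<f = contradiction v∈g (f-min g g<f)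

    -- The first occurrence of `v` is unique, so the climbs from both cliques end at the same place.
    -- This is the junction property in terms of walks.
    walkThrough : ∀ {i j} → v ∈ C i → v ∈ C j → WalkIn (λ x → v ∈ C x) i j
    walkThrough {v} {i} {j} v∈i v∈j = subst₂ (WalkIn _) (Perm.inverseʳ π) (Perm.inverseʳ π)
      (through (π ⟨$⟩ˡ i) (π ⟨$⟩ˡ j) (subst (λ x → v ∈ C x) (sym (Perm.inverseʳ π)) v∈i)
                                     (subst (λ x → v ∈ C x) (sym (Perm.inverseʳ π)) v∈j))
      where
      through : ∀ k l → v ∈ C (π ⟨$⟩ʳ k) → v ∈ C (π ⟨$⟩ʳ l) →
                WalkIn (λ x → v ∈ C x) (π ⟨$⟩ʳ k) (π ⟨$⟩ʳ l)
      through k l v∈k v∈l with climbToFirst k v∈k | climbToFirst l v∈l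
      ... | f , first-f , w | g , first-g , w′ , qs′
        with refl ← First-unique first-f first-g = w ++ʷ reverseʷ w′ qs′

    connected : Fin K → Connected Edge
    connected i = i , λ x y → subst₂ (Star Edge) (Perm.inverseʳ π) (Perm.inverseʳ π)
      (proj₁ (toRoot x ++ʷ reverseʷ (proj₁ (toRoot y)) (proj₂ (toRoot y))))
      where
      toRoot : ∀ x → WalkIn (λ _ → ⊤) _ _
      toRoot x = weaken (λ _ → tt) (climb (proj₂ (firstIndex i)) (π ⟨$⟩ˡ x))

    cliqueTree : Fin K → CliqueTree 𝒞
    cliqueTree i = record
      { tree     = graph
      ; isTree   = connected i , acyclic
      ; junction = λ p isPath k∈p v∈ → let v∈i , v∈j = x∈p∩q⁻ _ _ v∈ in
                     All.lookup (path-within acyclic p isPath (walkThrough v∈i v∈j)) k∈p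
      }

  generate : (Π : PerfectSequence 𝒞) (choice : Fin K → Fin K)
             (isChoice : IsChoice (PerfectSequence.perm Π) choice) (i : Fin K) →
             Generates 𝒞 Π (Generated.cliqueTree (PerfectSequence.perm Π) choice isChoice i)
  generate Π choice isChoice i = choice , isChoice , λ _ _ → ⇔-id _

-- Search orders of a clique tree

-- A list built from its end: the latest element comes first, and each element
-- other than the initial r satisfies Ok with respect to the elements before it.
data Build {A : Set} (Ok : A → List A → Set) (r : A) : List A → Set where
  initial : Build Ok r (r ∷ [])
  add     : ∀ {v L} → v List.∉ L → Ok v L → Build Ok r L → Build Ok r (v ∷ L)

module _ {A : Set} {Ok : A → List A → Set} {r : A} where

  Build-unique : ∀ {L} → Build Ok r L → Unique L
  Build-unique initial       = [] ∷ []
  Build-unique (add v∉L _ b) = ¬Any⇒All¬ _ v∉L ∷ Build-unique b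

  Build-last : ∀ {L} → Build Ok r L → (i : Fin (length L)) → suc (toℕ i) ≡ length L →
               lookup L i ≡ r
  Build-last initial     zero    _ = refl
  Build-last (add _ _ initial) zero ()
  Build-last (add _ _ b) (suc i) p = Build-last b i (ℕ.suc-injective p)

  -- `E` is the part of the list behind index `i`: the latest element stands first, so larger
  -- indices are earlier. The bound on `i` excludes the initial `r`, which has the last index.
  Build-ok : ∀ {L} → Build Ok r L → (i : Fin (length L)) → suc (toℕ i) ℕ.< length L →
             Σ[ E ∈ List A ] Ok (lookup L i) E ×
               (∀ {j} → i Fin.< j → lookup L j List.∈ E) ×
               (∀ {u} → u List.∈ E → ∃[ j ] i Fin.< j × lookup L j ≡ u)
  Build-ok initial zero (s≤s ())
  Build-ok (add {L = L} _ ok _) zero _ = L , ok , (λ { {suc j} _ → ∈-lookup j }) ,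
    λ u∈L → suc (Any.index u∈L) , s≤s z≤n , sym (Any.lookup-index u∈L)
  Build-ok (add {L = L} _ _ b) (suc i) (s≤s p) with Build-ok b i p
  ... | E , ok , to , from = E , ok , (λ { {suc j} (s≤s i<j) → to i<j }) ,
    λ u∈E → let j , i<j , q = from u∈E in suc j , s≤s i<j , q

-- Composing with `opposite` turns a list built from its end into an order read from its beginning.
-- The equality `m ≡ K` comes from the bijection and is matched on in `go`.
reindex : ∀ {m K} (f : Fin m → Fin K) → (∀ i j → f i ≡ f j → i ≡ j) →
          (∀ y → ∃[ i ] f i ≡ y) →
          Σ[ π ∈ Permutation′ K ] Σ[ g ∈ (Fin K → Fin m) ]
            (∀ k → π ⟨$⟩ʳ k ≡ f (g k)) × (∀ k → toℕ (g k) ≡ m ℕ.∸ suc (toℕ k)) × m ≡ K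
reindex f f-inj f-surj = go f f-inj f-surj (Perm.↔⇒≡ (Perm.permutation f (λ y → proj₁ (f-surj y))
    (λ y → proj₂ (f-surj y)) (λ i → f-inj _ _ (proj₂ (f-surj (f i))))))
  where
  go : ∀ {m K} (f : Fin m → Fin K) → (∀ i j → f i ≡ f j → i ≡ j) →
       (∀ y → ∃[ i ] f i ≡ y) → m ≡ K →
       Σ[ π ∈ Permutation′ K ] Σ[ g ∈ (Fin K → Fin m) ]
         (∀ k → π ⟨$⟩ʳ k ≡ f (g k)) × (∀ k → toℕ (g k) ≡ m ℕ.∸ suc (toℕ k)) × m ≡ K
  go f f-inj f-surj refl =
    Perm.permutation (f ∘ opposite) (λ y → opposite (proj₁ (f-surj y)))
      (λ y → trans (cong f (Fin.opposite-involutive _)) (proj₂ (f-surj y)))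
      (λ k → trans (cong opposite (f-inj _ _ (proj₂ (f-surj (f (opposite k))))))
                   (Fin.opposite-involutive k)) ,
    opposite , (λ _ → refl) , Fin.opposite-prop , refl

-- The two inclusions determine `E` up to order and repetition, which is all that the instances of
-- `Ok` depend on.
record Ordering {K : ℕ} (Ok : Fin K → List (Fin K) → Set) (r : Fin K) : Set where
  field
    perm  : Permutation′ K
    first : ∀ k → toℕ k ≡ 0 → perm ⟨$⟩ʳ k ≡ r
    ok    : ∀ k → 0 ℕ.< toℕ k → Σ[ E ∈ List (Fin K) ] Ok (perm ⟨$⟩ʳ k) E ×
              (∀ {j} → j Fin.< k → perm ⟨$⟩ʳ j List.∈ E) ×
              (∀ {u} → u List.∈ E → ∃[ j ] j Fin.< k × perm ⟨$⟩ʳ j ≡ u)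

ordering : ∀ {K} {Ok : Fin K → List (Fin K) → Set} {r L} →
           Build Ok r L → (∀ x → x List.∈ L) → Ordering Ok r
ordering {K} {Ok} {r} {L} b complete
  with reindex (lookup L) (lookup-injective (Build-unique b))
         (λ y → Any.index (complete y) , sym (Any.lookup-index (complete y)))
... | π , g , π≡ , g≡ , len = record
  { perm  = π
  ; first = λ k k≡0 → trans (π≡ k) (Build-last b (g k) (trans (suc-g k) (cong (length L ℕ.∸_) k≡0)))
  ; ok    = λ k 0<k →
      let E , ok , to , from = Build-ok b (g k)
            (ℕ.≤-<-trans (ℕ.≤-reflexive (suc-g k))
              (ℕ.∸-monoʳ-< 0<k (ℕ.<⇒≤ (k< k)))) in
      E , subst (λ v → Ok v E) (sym (π≡ k)) ok ,
      (λ {j} j<k → subst (List._∈ E) (sym (π≡ j)) (to (subst₂ ℕ._<_ (sym (g≡ k)) (sym (g≡ j))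
          (ℕ.∸-monoʳ-< (s≤s j<k) (k< k))))) ,
      -- `back` identifies `i` as the list index of the position of `u`; since `g` reverses the
      -- order, an index behind `g k` means a position before `k`.
      λ {u} u∈E → let i , gk<i , q = from u∈E in
        π ⟨$⟩ˡ u ,
        ℕ.≰⇒> (λ k≤j → ℕ.<⇒≱ (subst (g k Fin.<_) (back u i q) gk<i)
          (subst₂ ℕ._≤_ (sym (g≡ (π ⟨$⟩ˡ u))) (sym (g≡ k)) (ℕ.∸-monoʳ-≤ (length L) (s≤s k≤j)))) ,
        Perm.inverseʳ π
  }
  where
  k< : ∀ k → toℕ k ℕ.< length L
  k< k = subst (toℕ k ℕ.<_) (sym len) (Fin.toℕ<n k)
  suc-g : ∀ k → suc (toℕ (g k)) ≡ length L ℕ.∸ toℕ k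
  suc-g k = trans (cong suc (g≡ k)) (sym (ℕ.+-∸-assoc 1 (k< k)))
  back : ∀ u i → lookup L i ≡ u → i ≡ g (π ⟨$⟩ˡ u)
  back u i q = lookup-injective (Build-unique b) i _
    (trans q (trans (sym (Perm.inverseʳ π)) (π≡ (π ⟨$⟩ˡ u))))

pickParents : ∀ {K} (P : Fin K → Fin K → Set) → (∀ k → 0 ℕ.< toℕ k → ∃[ j ] P k j) →
              Σ[ c ∈ (Fin K → Fin K) ] (∀ k → 0 ℕ.< toℕ k → P k (c k))
pickParents P h = (λ k → proj₁ (pick k)) , λ k → proj₂ (pick k)
  where
  pick : ∀ k → ∃[ j ] (0 ℕ.< toℕ k → P k j)
  pick k with 0 ℕ.<? toℕ k
  ... | yes p = let j , q = h k p in j , λ _ → q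
  -- Position 0 receives a dummy value, its condition being vacuous.
  ... | no ¬p = k , λ p → contradiction p ¬p

module _ {K : ℕ} (T : Graph K) where
  open Walks T
  open import Data.List.Membership.DecPropositional (_≟_ {K}) using () renaming (_∈?_ to _∈ˡ?_)

  Attached : Fin K → List (Fin K) → Set
  Attached v L = ∃[ p ] p List.∈ L × Adj T v p

  -- `U` contains all nodes still missing from `L`. If its head is missing, a walk from `r` to that
  -- head leaves `L` along some edge, and the outer end of this edge, not necessarily the head, is
  -- added next.
  grow : ∀ {r L} fuel (U : List (Fin K)) → length U ℕ.≤ fuel → r List.∈ L →
         (∀ x y → Star (Adj T) x y) → (∀ x → x List.∈ L ⊎ x List.∈ U) →
         Build Attached r L → Σ[ M ∈ List (Fin K) ] Build Attached r M × (∀ x → x List.∈ M)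
  grow {L = L} fuel [] _ r∈L conn cover b = L , b , λ x → Sum.[ (λ x∈L → x∈L) , (λ ()) ] (cover x)
  grow {r} {L} (suc fuel) U@(x ∷ V) (s≤s V≤) r∈L conn cover b with x ∈ˡ? L
  ... | yes x∈L = grow fuel V V≤ r∈L conn
          (λ y → Sum.[ inj₁ , (λ { (here refl) → inj₁ x∈L ; (there y∈V) → inj₂ y∈V }) ] (cover y)) b
  ... | no x∉L with cross (_∈ˡ? L) (conn r x) r∈L x∉L
  ...   | crossing {p} {v} _ step _ p∈L v∉L _ =
    grow fuel (filter (λ y → ¬? (y ≟ v)) U)
      (ℕ.s≤s⁻¹ (ℕ.<-≤-trans (filter-notAll (λ y → ¬? (y ≟ v)) U
        (Any.map (λ v≡y y≢v → y≢v (sym v≡y))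
          (Sum.[ (λ v∈L → contradiction v∈L v∉L) , (λ v∈U → v∈U) ] (cover v))))
        (s≤s V≤)))
      (there r∈L) conn cover′ (add v∉L (p , p∈L , Graph.sym T step) b)
    where
    cover′ : ∀ y → y List.∈ (v ∷ L) ⊎ y List.∈ filter (λ y → ¬? (y ≟ v)) U
    cover′ y with y ≟ v | cover y
    ... | yes refl | _        = inj₁ (here refl)
    ... | no  _    | inj₁ y∈L = inj₁ (there y∈L)
    ... | no  y≢v  | inj₂ y∈U = inj₂ (∈-filter⁺ (λ y → ¬? (y ≟ v)) y∈U y≢v)

  searchOrdering : (∀ x y → Star (Adj T) x y) → ∀ r → Ordering Attached r
  searchOrdering conn r = let _ , b , complete = grow _ (allFin K) ℕ.≤-refl (here refl) conn
                                (λ x → inj₂ (∈-allFin x)) initial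
                          in ordering b complete

module _ {n : ℕ} {G : Graph n} (𝒞 : MaximalCliques G) where
  open MaximalCliques 𝒞 using (K; C; maximal)

  separator⊆ : ∀ π k → separator 𝒞 π k ⊆ C (π ⟨$⟩ʳ k)
  separator⊆ π k = p∩q⊆q _ (C (π ⟨$⟩ʳ k))

  separator-clique : ∀ π k → IsClique G (separator 𝒞 π k)
  separator-clique π k u∈ v∈ = proj₁ (maximal (π ⟨$⟩ʳ k)) (separator⊆ π k u∈) (separator⊆ π k v∈)

  -- Translates the inclusion demanded of a perfect sequence into the equation demanded of a choice:
  -- the separator contains the intersection of the clique at `k` with each earlier clique.
  separator-parent : ∀ π {k l} → l Fin.< k → separator 𝒞 π k ⊆ C (π ⟨$⟩ʳ l) →
                     separator 𝒞 π k ≡ C (π ⟨$⟩ʳ l) ∩ C (π ⟨$⟩ʳ k)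
  separator-parent π {k} l<k sep = ⊆-antisym (λ v∈ → x∈p∩q⁺ (sep v∈ , separator⊆ π k v∈))
    (λ v∈ → let v∈l , v∈k = x∈p∩q⁻ _ _ v∈ in ∈-separator⁺ 𝒞 π l<k v∈l v∈k)

  perfectSequence : ∀ π choice → IsChoice 𝒞 π choice → PerfectSequence 𝒞
  perfectSequence π choice isChoice = record
    { perm    = π
    ; perfect = λ k 0<k → let c<k , eq = isChoice k 0<k in
        separator-clique π k , choice k , c<k , λ v∈ → p∩q⊆p _ (C (π ⟨$⟩ʳ k)) (subst (_ ∈_) eq v∈)
    }

  chooseParents : (Π : PerfectSequence 𝒞) →
                  Σ[ choice ∈ (Fin K → Fin K) ] IsChoice 𝒞 (PerfectSequence.perm Π) choice
  chooseParents Π = pickParents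
    (λ k l → l Fin.< k × separator 𝒞 π k ≡ C (π ⟨$⟩ʳ l) ∩ C (π ⟨$⟩ʳ k))
    λ k 0<k → let _ , l , l<k , sep = perfect k 0<k in l , l<k , separator-parent π l<k sep
    where open PerfectSequence Π renaming (perm to π)

  module Search (T : CliqueTree 𝒞) (π : Permutation′ K) (choice : Fin K → Fin K)
    (r : Fin K) (r≡0 : toℕ r ≡ 0)
    (up : ∀ k → 0 ℕ.< toℕ k →
            choice k Fin.< k × Adj (CliqueTree.tree T) (π ⟨$⟩ʳ k) (π ⟨$⟩ʳ choice k)) where
    open CliqueTree T
    open Walks tree
    open Climbing tree π choice up

    private
      Before : Fin K → Fin K → Set
      Before k x = π ⟨$⟩ʳ k ≢ x

      below : ∀ {j k x} → j Fin.< k → UpTo j x → Before k x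
      below j<k (i , i≤j , refl) q =
        Fin.<-irrefl (perm-injective π (sym q))
                     (ℕ.≤-<-trans i≤j j<k)

    avoiding : ∀ {i j k} → i Fin.< k → j Fin.< k →
               WalkIn (π ⟨$⟩ʳ k ≢_) (π ⟨$⟩ʳ i) (π ⟨$⟩ʳ j)
    avoiding {i} {j} i<k j<k = weaken (below i<k) (climb r≡0 i) ++ʷ
      (let w , qs = weaken (below j<k) (climb r≡0 j) in reverseʷ w qs)

    -- Let `v` lie in the clique at `k` and in an earlier one at `j`. The edge from `k` to its
    -- parent, followed by a path to `j` avoiding `k`, is the tree path from `k` to `j`; it contains
    -- the parent, so the junction property puts `v` there.
    isChoice : IsChoice 𝒞 π choice
    isChoice k 0<k with up k 0<k
    ... | c<k , e = c<k , separator-parent π c<k sep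
      where
      sep : separator 𝒞 π k ⊆ C (π ⟨$⟩ʳ choice k)
      sep v∈ with ∈-separator⁻ 𝒞 π v∈
      ... | (j , j<k , v∈j) , v∈k with avoiding c<k j<k
      ...   | w , qs with chordlessPath w qs
      ...     | path p isPath _ inside =
        junction (e ◅ p) (inside ∷ isPath) (there (start∈ p)) (x∈p∩q⁺ (v∈k , v∈j))

    -- Two different earlier neighbours of one node would be joined by a walk avoiding it. Hence `T`
    -- has no edges beyond the parent edges.
    isParent : ∀ {j k} → j Fin.< k → Adj tree (π ⟨$⟩ʳ k) (π ⟨$⟩ʳ j) → choice k ≡ j
    isParent {j} {k} j<k e with choice k ≟ j
    ... | yes q = q
    ... | no ¬q with up k (0<⇐< j<k)
    ...   | c<k , f = contradiction (avoiding c<k j<k)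
      (noDetour (proj₂ isTree) e f λ q → ¬q (perm-injective π q))

    generates : Generates 𝒞 (perfectSequence π choice isChoice) T
    generates = choice , isChoice , λ i j → mk⇔ (to i j) from
      where
      from : ∀ {i j} → Generated.Edge 𝒞 π choice isChoice i j → Adj tree i j
      from (k , 0<k , inj₁ (refl , refl)) = proj₂ (up k 0<k)
      from (k , 0<k , inj₂ (refl , refl)) = Graph.sym tree (proj₂ (up k 0<k))
      edge : ∀ k l → Adj tree (π ⟨$⟩ʳ k) (π ⟨$⟩ʳ l) →
             Generated.Edge 𝒞 π choice isChoice (π ⟨$⟩ʳ k) (π ⟨$⟩ʳ l)
      edge k l e with Fin.<-cmp k l
      ... | tri< k<l _ _ = l , 0<⇐< k<l ,
        inj₂ (cong (π ⟨$⟩ʳ_) (sym (isParent k<l (Graph.sym tree e))) , refl)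
      ... | tri≈ _ refl _ = contradiction e (Graph.irrefl tree refl)
      ... | tri> _ _ l<k = k , 0<⇐< l<k , inj₁ (refl , cong (π ⟨$⟩ʳ_) (sym (isParent l<k e)))
      to : ∀ i j → Adj tree i j → Generated.Edge 𝒞 π choice isChoice i j
      to i j e = subst₂ (Generated.Edge 𝒞 π choice isChoice) (Perm.inverseʳ π) (Perm.inverseʳ π)
        (edge _ _ (subst₂ (Adj tree) (sym (Perm.inverseʳ π)) (sym (Perm.inverseʳ π)) e))

  rootedSequence : (T : CliqueTree 𝒞) (a : Fin K) →
    Σ[ Π ∈ PerfectSequence 𝒞 ] Generates 𝒞 Π T ×
      (∀ k → toℕ k ≡ 0 → PerfectSequence.perm Π ⟨$⟩ʳ k ≡ a)
  rootedSequence T a with searchOrdering (CliqueTree.tree T) (proj₂ (proj₁ (CliqueTree.isTree T))) a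
  ... | record { perm = π ; first = first ; ok = ok } = perfectSequence π choice isChoice , generates , first
    where
    parents : Σ[ c ∈ (Fin K → Fin K) ] (∀ k → 0 ℕ.< toℕ k →
                c k Fin.< k × Adj (CliqueTree.tree T) (π ⟨$⟩ʳ k) (π ⟨$⟩ʳ c k))
    parents = pickParents (λ k j → j Fin.< k × Adj (CliqueTree.tree T) (π ⟨$⟩ʳ k) (π ⟨$⟩ʳ j)) λ k 0<k →
      let _ , (p , p∈E , e) , _ , from = ok k 0<k
          j , j<k , q = from p∈E
      in j , j<k , subst (Adj (CliqueTree.tree T) _) (sym q) e
    choice = proj₁ parents
    open Search T π choice (proj₁ (firstIndex a)) (proj₂ (firstIndex a)) (proj₂ parents)

-- Exchanging edges of clique trees

module _ {n : ℕ} (T : Graph n) (isTree : IsTree T) where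
  open Walks T

  private
    acyclic = proj₂ isTree
    pathTo : ∀ x y → Path (λ _ → ⊤) x y
    pathTo x y = let w = proj₂ (proj₁ isTree) x y in
                 chordlessPath w (All.universal (λ _ → tt) _)

  treePath : ∀ x y → Σ[ p ∈ Star (Adj T) x y ] IsPath p
  treePath x y = Path.walk (pathTo x y) , Path.isPath (pathTo x y)

  -- `P` is the side of `a` in the tree with `ab` deleted, encoded decidably: the tree path to `b`
  -- passes through `a`.
  cut : ∀ {a b} → Adj T a b → Σ[ P ∈ Pred (Fin n) 0ℓ ] Decidable P × P a × ¬ P b ×
          (∀ {x y} → Adj T x y → P x → ¬ P y → x ≡ a × y ≡ b)
  cut {a} {b} ab = P , P? , start∈ (proj₁ (treePath a b)) , ¬Pb , only
    where
    P : Pred (Fin n) 0ℓ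
    P x = a List.∈ vertices (proj₁ (treePath x b))
    P? : Decidable P
    P? x = Any.any? (a ≟_) (vertices (proj₁ (treePath x b)))
    ¬Pb : ¬ P b
    ¬Pb a∈ with subst (a List.∈_) (path-unique acyclic (proj₁ (treePath b b)) ε (proj₂ (treePath b b)) ([] ∷ [])) a∈
    ... | here a≡b = Graph.irrefl T a≡b ab
    only : ∀ {x y} → Adj T x y → P x → ¬ P y → x ≡ a × y ≡ b
    only {x} {y} xy a∈x a∉y with x ≟ a
    ... | no x≢a = contradiction refl (All.lookup
      (path-within acyclic (proj₁ (treePath x b)) (proj₂ (treePath x b))
        (xy ◅ proj₁ (treePath y b) , (λ a≡x → x≢a (sym a≡x)) ∷ ¬Any⇒All¬ _ a∉y)) a∈x)
    ... | yes refl with y ≟ b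
    ...   | yes y≡b = refl , y≡b
    ...   | no  y≢b = contradiction (proj₁ (treePath y b) , ¬Any⇒All¬ _ a∉y)
                                    (noDetour acyclic ab xy y≢b)

  -- `T` already joins the ends of each edge of `U`, so an edge of `U` missing from `T` would close
  -- a cycle with a path of `T`.
  spanning-⊆ : (U : Graph n) → Acyclic U → (∀ {i j} → Adj T i j → Adj U i j) →
               ∀ {i j} → Adj U i j → Adj T i j
  spanning-⊆ U U-acyclic T⊆U {i} {j} ij with Graph.adj? T i j
  ... | yes e = e
  ... | no ¬e with treePath i j
  ...   | ε , _ = contradiction ij (Graph.irrefl U refl)
  ...   | _◅_ {j = k} ik p , i∉p ∷ _ = contradiction (go p i∉p)
    (Walks.noDetour U U-acyclic ij (T⊆U ik) λ { refl → ¬e ik })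
    where
    go : ∀ {x y} (p : Star (Adj T) x y) → All (i ≢_) (vertices p) → Walks.WalkIn U (i ≢_) x y
    go ε q = ε , q
    go (e ◅ p) (q ∷ qs) = let w , rs = go p qs in T⊆U e ◅ w , q ∷ rs

SameEdge : ∀ {K} → Fin K → Fin K → Fin K → Fin K → Set
SameEdge i j c d = (i ≡ c × j ≡ d) ⊎ (i ≡ d × j ≡ c)

module _ {n : ℕ} {G : Graph n} (𝒞 : MaximalCliques G) where
  open MaximalCliques 𝒞 using (K; C)

  infix 4 _⇝_
  _⇝_ : CliqueTree 𝒞 → CliqueTree 𝒞 → Set₁
  T ⇝ T′ = Star (BipartiteAdj 𝒞) (inj₁ T) (inj₁ T′)

  common : ∀ {T T′} Π → Generates 𝒞 Π T → Generates 𝒞 Π T′ → T ⇝ T′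
  common Π g g′ = _◅_ {j = inj₂ Π} g (g′ ◅ ε)

  -- In a sequence starting at a and generating T, the clique b is joined to c;
  -- joining it to a instead generates the new tree.
  exchangeIn : (T : CliqueTree 𝒞) (Π : PerfectSequence 𝒞) → Generates 𝒞 Π T → ∀ {a b c} →
    (∀ k → toℕ k ≡ 0 → PerfectSequence.perm Π ⟨$⟩ʳ k ≡ a) → Adj (CliqueTree.tree T) c b →
    Walks.WalkIn (CliqueTree.tree T) (b ≢_) a c → C a ∩ C b ≡ C c ∩ C b →
    Σ[ T′ ∈ CliqueTree 𝒞 ] T ⇝ T′ × Adj (CliqueTree.tree T′) a b ×
      (∀ {i j} → Adj (CliqueTree.tree T) i j → ¬ SameEdge i j c b → Adj (CliqueTree.tree T′) i j)
  exchangeIn T Π g@(choice , isChoice , edges) {a} {b} {c} first cb (q , b∉q) eq =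
    Generated.cliqueTree 𝒞 π choice′ isChoice′ a ,
    common Π g (generate 𝒞 Π choice′ isChoice′ a) , new , keep
    where
    open CliqueTree T
    open Walks tree
    π = PerfectSequence.perm Π
    r = proj₁ (firstIndex a)
    r≡0 = proj₂ (firstIndex a)
    k = π ⟨$⟩ˡ b
    πk≡b : π ⟨$⟩ʳ k ≡ b
    πk≡b = Perm.inverseʳ π
    0<k : 0 ℕ.< toℕ k
    0<k = ℕ.n≢0⇒n>0 λ k≡0 → start q b∉q (trans (sym πk≡b) (first k k≡0))
    open Climbing tree π choice
      (λ k 0<k → proj₁ (isChoice k 0<k) , Equivalence.from (edges _ _) (k , 0<k , inj₁ (refl , refl)))
    -- A parent of `b` other than `c` would climb to the root `a`, which reaches `c` along `q`, all
    -- without meeting `b`; two neighbours of `b` would thus be joined off `b`.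
    b-parent : π ⟨$⟩ʳ choice k ≡ c
    b-parent with Equivalence.to (edges c b) cb
    ... | l , 0<l , inj₂ (c≡ , b≡) = trans (cong (λ k → π ⟨$⟩ʳ choice k) (position π b≡)) (sym c≡)
    ... | l , 0<l , inj₁ (c≡ , b≡) with π ⟨$⟩ʳ choice k ≟ c
    ...   | yes p = p
    ...   | no ¬p = contradiction (toRoot ++ʷ (q , b∉q)) (noDetour (proj₂ isTree) (Graph.sym tree cb)
              (Equivalence.from (edges _ _) (k , 0<k , inj₁ (sym πk≡b , refl))) ¬p)
      where
      toRoot : WalkIn (b ≢_) (π ⟨$⟩ʳ choice k) a
      toRoot = subst (WalkIn _ _) (first r r≡0) (weaken
        (λ (j , j≤ , πj≡x) b≡x → Fin.<-irrefl (sym (position π (trans b≡x (sym πj≡x))))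
          (ℕ.≤-<-trans j≤ (proj₁ (isChoice k 0<k)))) (climb r≡0 (choice k)))
    choice′ : Fin K → Fin K
    choice′ l with l ≟ k
    ... | yes _ = r
    ... | no  _ = choice l
    isChoice′ : IsChoice 𝒞 π choice′
    isChoice′ l 0<l with l ≟ k
    ... | no _ = isChoice l 0<l
    ... | yes refl = subst (ℕ._< toℕ k) (sym r≡0) 0<k , (begin
      separator 𝒞 π k                             ≡⟨ proj₂ (isChoice k 0<k) ⟩
      C (π ⟨$⟩ʳ choice k) ∩ C (π ⟨$⟩ʳ k)         ≡⟨ cong₂ (λ x y → C x ∩ C y) b-parent πk≡b ⟩
      C c ∩ C b                                    ≡⟨ eq ⟨
      C a ∩ C b                                    ≡⟨ cong₂ (λ x y → C x ∩ C y) (first r r≡0) πk≡b ⟨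
      C (π ⟨$⟩ʳ r) ∩ C (π ⟨$⟩ʳ k)                ∎)
      where open ≡-Reasoning
    choice′-k : choice′ k ≡ r
    choice′-k with k ≟ k
    ... | yes _ = refl
    ... | no ¬p = contradiction refl ¬p
    choice′-≢ : ∀ {l} → l ≢ k → choice′ l ≡ choice l
    choice′-≢ {l} l≢k with l ≟ k
    ... | yes p = contradiction p l≢k
    ... | no  _ = refl
    new : Generated.Edge 𝒞 π choice′ isChoice′ a b
    new = k , 0<k , inj₂ (sym (trans (cong (π ⟨$⟩ʳ_) choice′-k) (first r r≡0)) , sym πk≡b)
    keep : ∀ {i j} → Adj tree i j → ¬ SameEdge i j c b → Generated.Edge 𝒞 π choice′ isChoice′ i j
    keep {i} {j} ij ¬cb with Equivalence.to (edges i j) ij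
    ... | l , 0<l , e with l ≟ k
    ...   | no l≢k = l , 0<l , subst
      (λ m → (i ≡ π ⟨$⟩ʳ l × j ≡ π ⟨$⟩ʳ m) ⊎ (i ≡ π ⟨$⟩ʳ m × j ≡ π ⟨$⟩ʳ l)) (sym (choice′-≢ l≢k)) e
    ...   | yes refl = contradiction
      (Sum.swap (Sum.map (λ (p , q) → trans p πk≡b , trans q b-parent)
                         (λ (p , q) → trans p b-parent , trans q πk≡b) e)) ¬cb

  exchange : (T : CliqueTree 𝒞) → ∀ {a b c} → Adj (CliqueTree.tree T) c b →
    Walks.WalkIn (CliqueTree.tree T) (b ≢_) a c → C a ∩ C b ≡ C c ∩ C b →
    Σ[ T′ ∈ CliqueTree 𝒞 ] T ⇝ T′ × Adj (CliqueTree.tree T′) a b ×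
      (∀ {i j} → Adj (CliqueTree.tree T) i j → ¬ SameEdge i j c b → Adj (CliqueTree.tree T′) i j)
  exchange T {a} = let Π , g , first = rootedSequence 𝒞 T a in exchangeIn T Π g first

  -- `cd` is replaced by `ad`, with common end `d`, and then `ad` by `ab`, with common end `a`. Both
  -- removed edges cross the cut `P`, which `ab` alone crosses in `T′`; so no edge common to `T` and
  -- `T′` is lost.
  exchangeAcross : (T T′ : CliqueTree 𝒞) → ∀ {a b} {P : Pred (Fin K) 0ℓ} → Decidable P → P a → ¬ P b →
    (∀ {x y} → Adj (CliqueTree.tree T′) x y → P x → ¬ P y → x ≡ a × y ≡ b) →
    (p : Star (Adj (CliqueTree.tree T)) a b) → IsPath p → Walks.Crossing (CliqueTree.tree T) P p →
    Σ[ U ∈ CliqueTree 𝒞 ] T ⇝ U × Adj (CliqueTree.tree U) a b ×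
      (∀ {i j} → Adj (CliqueTree.tree T) i j → Adj (CliqueTree.tree T′) i j →
                 Adj (CliqueTree.tree U) i j)
  exchangeAcross T T′ {a} {b} {P} P? Pa ¬Pb only p p-path (Walks.crossing {c} {d} p₁ cd p₂ Pc ¬Pd split) =
    let T₁ , T⇝T₁ , ad , keep₁ = exchange T cd (p₁ , d∉p₁) eq₁
        T₂ , T₁⇝T₂ , ba , keep₂ = exchange T₁ (Graph.sym (CliqueTree.tree T₁) ad) (b→d T₁ keep₁) eq₂
    in T₂ , T⇝T₁ ◅◅ T₁⇝T₂ , Graph.sym (CliqueTree.tree T₂) ba , keep T₁ T₂ keep₁ ba keep₂
    where
    open CliqueTree T
    open CliqueTree T′ renaming (tree to tree′; isTree to isTree′; junction to junction′)
    open Walks tree hiding (crossing)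
    ∈p₁⇒∈p : ∀ {x} → x List.∈ vertices p₁ → x List.∈ vertices p
    ∈p₁⇒∈p x∈ = subst (_ List.∈_) (sym split) (∈-++⁺ˡ x∈)
    ∈p₂⇒∈p : ∀ {x} → x List.∈ vertices p₂ → x List.∈ vertices p
    ∈p₂⇒∈p x∈ = subst (_ List.∈_) (sym split) (∈-++⁺ʳ (vertices p₁) x∈)
    apart : ∀ {x y} → x List.∈ vertices p₁ → y List.∈ vertices p₂ → x ≢ y
    apart = ++-apart (vertices p₁) (subst Unique split p-path)
    d∉p₁ : All (d ≢_) (vertices p₁)
    d∉p₁ = All.tabulate λ x∈ d≡x → apart x∈ (start∈ p₂) (sym d≡x)
    -- The rest `p₂` of the path survives the first exchange because `c` lies on `p₁` and the two
    -- parts are disjoint; for the same reason it avoids `a`.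
    b→d : (T₁ : CliqueTree 𝒞) →
      (∀ {i j} → Adj tree i j → ¬ SameEdge i j c d → Adj (CliqueTree.tree T₁) i j) →
      Walks.WalkIn (CliqueTree.tree T₁) (a ≢_) b d
    b→d T₁ keep₁ = let w , qs = go p₂ (λ y∈ → y∈) in Walks.reverseʷ (CliqueTree.tree T₁) w qs
      where
      go : ∀ {x y} (w : Star (Adj tree) x y) → (∀ {z} → z List.∈ vertices w → z List.∈ vertices p₂) →
           Walks.WalkIn (CliqueTree.tree T₁) (a ≢_) x y
      go ε w⊆ = ε , apart (start∈ p₁) (w⊆ (here refl)) ∷ []
      go (e ◅ w) w⊆ = let w′ , qs = go w (λ z∈ → w⊆ (there z∈)) in
        keep₁ e (λ { (inj₁ (refl , refl)) → apart (end∈ p₁) (w⊆ (here refl)) refl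
                   ; (inj₂ (refl , refl)) → apart (end∈ p₁) (w⊆ (there (start∈ w))) refl }) ◅ w′ ,
        apart (start∈ p₁) (w⊆ (here refl)) ∷ qs
    -- The path of `T′` from `x` to `y` must use the edge `ab`, so the junction property of `T′`
    -- applies at both `a` and `b`.
    through-cut : ∀ {x y} → P x → ¬ P y → C x ∩ C y ⊆ C a ∩ C b
    through-cut {x} {y} Px ¬Py v∈ with treePath tree′ isTree′ x y
    ... | r , r-path with Walks.cross tree′ P? r Px ¬Py
    ...   | Walks.crossing r₁ fg r₂ Pf ¬Pg r-split with refl , refl ← only fg Pf ¬Pg =
      x∈p∩q⁺ (junction′ r r-path (subst (_ List.∈_) (sym r-split) (∈-++⁺ˡ (Walks.end∈ tree′ r₁))) v∈ ,
              junction′ r r-path (subst (_ List.∈_) (sym r-split) (∈-++⁺ʳ (vertices r₁) (Walks.start∈ tree′ r₂))) v∈)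
    ab⊆c : C a ∩ C b ⊆ C c
    ab⊆c = junction p p-path (∈p₁⇒∈p (end∈ p₁))
    ab⊆d : C a ∩ C b ⊆ C d
    ab⊆d = junction p p-path (∈p₂⇒∈p (start∈ p₂))
    -- The junction property of `T` at `c` and `d` combines with `through-cut` to make `C a ∩ C b`,
    -- `C a ∩ C d` and `C c ∩ C d` equal.
    eq₁ : C a ∩ C d ≡ C c ∩ C d
    eq₁ = ⊆-antisym
      (λ v∈ → x∈p∩q⁺ (ab⊆c (through-cut Pa ¬Pd v∈) , p∩q⊆q _ (C d) v∈))
      (λ v∈ → x∈p∩q⁺ (p∩q⊆p _ (C b) (through-cut Pc ¬Pd v∈) , p∩q⊆q _ (C d) v∈))
    eq₂ : C b ∩ C a ≡ C d ∩ C a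
    eq₂ = ⊆-antisym
      (λ v∈ → let v∈b , v∈a = x∈p∩q⁻ _ _ v∈ in x∈p∩q⁺ (ab⊆d (x∈p∩q⁺ (v∈a , v∈b)) , v∈a))
      (λ v∈ → let v∈d , v∈a = x∈p∩q⁻ _ _ v∈ in
              x∈p∩q⁺ (p∩q⊆q _ (C b) (through-cut Pa ¬Pd (x∈p∩q⁺ (v∈a , v∈d))) , v∈a))
    keep : (T₁ T₂ : CliqueTree 𝒞) →
      (∀ {i j} → Adj tree i j → ¬ SameEdge i j c d → Adj (CliqueTree.tree T₁) i j) →
      Adj (CliqueTree.tree T₂) b a →
      (∀ {i j} → Adj (CliqueTree.tree T₁) i j → ¬ SameEdge i j d a → Adj (CliqueTree.tree T₂) i j) →
      ∀ {i j} → Adj tree i j → Adj tree′ i j → Adj (CliqueTree.tree T₂) i j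
    keep T₁ T₂ keep₁ ba keep₂ {i} {j} ij ij′ with P? i | P? j
    ... | yes Pi | no ¬Pj with refl , refl ← only ij′ Pi ¬Pj = Graph.sym (CliqueTree.tree T₂) ba
    ... | no ¬Pi | yes Pj with refl , refl ← only (Graph.sym tree′ ij′) Pj ¬Pi = ba
    ... | yes Pi | yes Pj = keep₂
      (keep₁ ij λ { (inj₁ (refl , refl)) → ¬Pd Pj ; (inj₂ (refl , refl)) → ¬Pd Pi })
      λ { (inj₁ (refl , refl)) → ¬Pd Pi ; (inj₂ (refl , refl)) → ¬Pd Pj }
    ... | no ¬Pi | no ¬Pj = keep₂
      (keep₁ ij λ { (inj₁ (refl , refl)) → ¬Pi Pc ; (inj₂ (refl , refl)) → ¬Pj Pc })
      λ { (inj₁ (refl , refl)) → ¬Pj Pa ; (inj₂ (refl , refl)) → ¬Pi Pa }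

  exchangeToward : (T T′ : CliqueTree 𝒞) → ∀ {a b} → Adj (CliqueTree.tree T′) a b →
    Σ[ U ∈ CliqueTree 𝒞 ] T ⇝ U × Adj (CliqueTree.tree U) a b ×
      (∀ {i j} → Adj (CliqueTree.tree T) i j → Adj (CliqueTree.tree T′) i j →
                 Adj (CliqueTree.tree U) i j)
  exchangeToward T T′ {a} {b} ab with Graph.adj? (CliqueTree.tree T) a b
  ... | yes e = T , ε , e , λ ij _ → ij
  ... | no ¬e =
    let P , P? , Pa , ¬Pb , only = cut (CliqueTree.tree T′) (CliqueTree.isTree T′) ab
        p , p-path = treePath (CliqueTree.tree T) (CliqueTree.isTree T) a b
    in exchangeAcross T T′ P? Pa ¬Pb only p p-path (Walks.cross _ P? p Pa ¬Pb)

  -- The pairs are treated one by one. Each exchange keeps the edges common to the current tree and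
  -- `T′`, so edges gained before are retained.
  absorb : (T T′ : CliqueTree 𝒞) (es : List (Fin K × Fin K)) →
    Σ[ U ∈ CliqueTree 𝒞 ] T ⇝ U ×
      All (λ (i , j) → Adj (CliqueTree.tree T′) i j → Adj (CliqueTree.tree U) i j) es
  absorb T T′ [] = T , ε , []
  absorb T T′ ((a , b) ∷ es) with absorb T T′ es
  ... | U , T⇝U , all with Graph.adj? (CliqueTree.tree T′) a b
  ...   | no ¬ab = U , T⇝U , (λ ab → contradiction ab ¬ab) ∷ all
  ...   | yes ab = let V , U⇝V , ab∈V , keep = exchangeToward U T′ ab in
    V , T⇝U ◅◅ U⇝V , (λ _ → ab∈V) ∷ All.map (λ f ij → keep (f ij) ij) all

  -- The inclusion is an equality of edge sets, so a sequence generating `T` generates `U` by the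
  -- same choices. The two trees may still be different records, whence the detour through a
  -- sequence.
  common-⊆ : ∀ {T U} → (∀ {i j} → Adj (CliqueTree.tree T) i j → Adj (CliqueTree.tree U) i j) → U ⇝ T
  common-⊆ {T} {U} T⊆U =
    let Π , g@(choice , isChoice , edges) , _ = rootedSequence 𝒞 T (proj₁ (proj₁ (CliqueTree.isTree T)))
    in common Π (choice , isChoice , λ i j → mk⇔
         (λ ij → Equivalence.to (edges i j) (U⊆T ij))
         (λ e → T⊆U (Equivalence.from (edges i j) e))) g
    where
    U⊆T : ∀ {i j} → Adj (CliqueTree.tree U) i j → Adj (CliqueTree.tree T) i j
    U⊆T = spanning-⊆ (CliqueTree.tree T) (CliqueTree.isTree T)
            (CliqueTree.tree U) (proj₂ (CliqueTree.isTree U)) T⊆U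

  cliqueTrees-connected : (T T′ : CliqueTree 𝒞) → T ⇝ T′
  cliqueTrees-connected T T′ =
    let U , T⇝U , all = absorb T T′ (cartesianProduct (allFin K) (allFin K))
    in T⇝U ◅◅ common-⊆ λ {i} {j} → All.lookup all (∈-cartesianProduct⁺ (∈-allFin i) (∈-allFin j))

  -- Connectedness of the bipartite graph

  bipartite-connected : CliqueTree 𝒞 → Connected (BipartiteAdj 𝒞)
  bipartite-connected T = inj₁ T , λ x y → toTree x ◅◅ fromTree y
    where
    i = proj₁ (proj₁ (CliqueTree.isTree T))
    generated : (Π : PerfectSequence 𝒞) → ∃[ U ] Generates 𝒞 Π U
    generated Π = let choice , isChoice = chooseParents 𝒞 Π in
      Generated.cliqueTree 𝒞 (PerfectSequence.perm Π) choice isChoice i , generate 𝒞 Π choice isChoice i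
    toTree : ∀ x → Star (BipartiteAdj 𝒞) x (inj₁ T)
    toTree (inj₁ U) = cliqueTrees-connected U T
    toTree (inj₂ Π) = let U , g = generated Π in _◅_ {j = inj₁ U} g (cliqueTrees-connected U T)
    fromTree : ∀ x → Star (BipartiteAdj 𝒞) (inj₁ T) x
    fromTree (inj₁ U) = cliqueTrees-connected T U
    fromTree (inj₂ Π) = let U , g = generated Π in
      cliqueTrees-connected T U ◅◅ (_◅_ {j = inj₂ Π} g ε)

-- Simplicial vertices of chordal graphs

module Dirac {n : ℕ} (G : Graph n) (chordal : Chordal G) where
  open Graph G using (adj?; irrefl) renaming (sym to adj-sym)
  open Walks G

  private
    variable
      B U : List (Fin n)
      s t u v x y : Fin n

  -- The closed neighbourhood of `B`.
  Near : List (Fin n) → Fin n → Set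
  Near B x = Any (λ b → x ≡ b ⊎ Adj G x b) B

  near? : ∀ B x → Dec (Near B x)
  near? B x = any? (λ b → (x ≟ b) ⊎-dec adj? x b) B

  ConnectedSet : List (Fin n) → Set
  ConnectedSet B = ∃[ c ] (∀ {b} → b List.∈ B → WalkIn (List._∈ B) b c)

  ConnectedSet-∷ : ConnectedSet B → Near B y → ConnectedSet (y ∷ B)
  ConnectedSet-∷ {B} {y} (c , walks) near = c , λ { (here refl) → from-y ; (there b∈B) → old b∈B }
    where
    old : ∀ {b} → b List.∈ B → WalkIn (List._∈ (y ∷ B)) b c
    old b∈B = weaken there (walks b∈B)
    from-y : WalkIn (List._∈ (y ∷ B)) y c
    from-y with List.find near
    ... | b , b∈B , inj₁ refl = old b∈B
    ... | b , b∈B , inj₂ e    = let w , qs = old b∈B in e ◅ w , here refl ∷ qs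

  near-walk : ConnectedSet B → Near B s → Near B t →
              WalkIn (λ v → v ≡ s ⊎ v ≡ t ⊎ v List.∈ B) s t
  near-walk {B} {s} {t} (c , walks) ns nt =
    weaken Sum.[ inj₁ , (λ v∈B → inj₂ (inj₂ v∈B)) ] (out ns) ++ʷ
    (let w , qs = out nt in weaken (λ q → inj₂ q) (reverseʷ w qs))
    where
    out : ∀ {v} → Near B v → WalkIn (λ x → x ≡ v ⊎ x List.∈ B) v c
    out near with List.find near
    ... | b , b∈B , inj₁ refl = weaken inj₂ (walks b∈B)
    ... | b , b∈B , inj₂ e    = let w , qs = weaken inj₂ (walks b∈B) in e ◅ w , inj₁ refl ∷ qs

  -- Otherwise x would close a chordless path from s to t through B to a
  -- chordless cycle.
  near-neighbours-adjacent : ConnectedSet B → ¬ Near B x → Near B s → Near B t →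
                             Adj G x s → Adj G x t → s ≢ t → Adj G s t
  near-neighbours-adjacent {B} {x} {s} {t} conn far ns nt xs xt s≢t with adj? s t
  ... | yes st = st
  ... | no ¬st with (w , qs) ← near-walk conn ns nt with chordlessPath w qs
  ...   | path p unique chordless inside = contradiction
    (chordal (s≤s (long p)) (closeCycle p unique′ xs (adj-sym xt)))
    (closeCycle-chordless p unique′ chordless xs (adj-sym xt) only)
    where
    long : (p : Walk s t) → 3 ℕ.≤ length (vertices p)
    long ε                 = contradiction refl s≢t
    long (st ◅ ε)          = contradiction st ¬st
    long (_ ◅ (_ ◅ ε))     = s≤s (s≤s (s≤s z≤n))
    long (_ ◅ (_ ◅ _ ◅ _)) = s≤s (s≤s (s≤s z≤n))
    unique′ : Unique (x ∷ vertices p)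
    unique′ = All.map (λ { (inj₁ refl) refl → irrefl refl xs
                         ; (inj₂ (inj₁ refl)) refl → irrefl refl xt
                         ; (inj₂ (inj₂ v∈B)) refl → far (List.lose v∈B (inj₁ refl)) }) inside ∷ unique
    only : ∀ {v} → v List.∈ vertices p → Adj G x v → v ≡ s ⊎ v ≡ t
    only v∈p xv with All.lookup inside v∈p
    ... | inj₁ v≡s        = inj₁ v≡s
    ... | inj₂ (inj₁ v≡t) = inj₂ v≡t
    ... | inj₂ (inj₂ v∈B) = contradiction (List.lose v∈B (inj₂ xv)) far

  Simplicial : List (Fin n) → Fin n → Set
  Simplicial U x = ∀ {u v} → u List.∈ U → v List.∈ U → Adj G x u → Adj G x v → u ≢ v → Adj G u v

  remove : Fin n → List (Fin n) → List (Fin n)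
  remove x = filter (λ y → ¬? (y ≟ x))

  ∈-remove⁺ : y List.∈ U → y ≢ x → y List.∈ remove x U
  ∈-remove⁺ {x = x} = ∈-filter⁺ (λ y → ¬? (y ≟ x))

  ∈-remove⁻ : ∀ U → y List.∈ remove x U → y List.∈ U × y ≢ x
  ∈-remove⁻ {x = x} U = ∈-filter⁻ (λ y → ¬? (y ≟ x)) {xs = U}

  length-remove : x List.∈ U → length (remove x U) ℕ.< length U
  length-remove {x} {U} x∈U = filter-notAll (λ y → ¬? (y ≟ x)) U (Any.map (λ x≡y y≢x → y≢x (sym x≡y)) x∈U)

  -- Dirac's theorem in a form suited to induction: the simplicial vertex also avoids the closed
  -- neighbourhood of a connected set `B`, which need not lie in `U`.
  FarSimplicial : List (Fin n) → Set
  FarSimplicial U = ∀ {B} → ConnectedSet B → ∀ {x} → x List.∈ U → ¬ Near B x →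
                    ∃[ y ] y List.∈ U × ¬ Near B y × Simplicial U y

  -- In a complete `R` any vertex serves. Otherwise `rec` is applied to `R` without `u`, with `B`
  -- consisting of `u` and with a non-neighbour `v` of `u` as the far vertex; the vertex found is
  -- not adjacent to `u`, so restoring `u` leaves it simplicial.
  simplicialIn : ∀ R → (∀ U → length U ℕ.< length R → FarSimplicial U) →
                 x List.∈ R → ∃[ y ] y List.∈ R × Simplicial R y
  simplicialIn {x} R rec x∈R
    with any? (λ u → any? (λ v → ¬? (v ≟ u) ×-dec ¬? (adj? v u)) R) R
  ... | no ¬p = x , x∈R , λ {u} {v} u∈R v∈R _ _ u≢v → decidable-stable (adj? u v) λ ¬uv →
    ¬p (List.lose v∈R (List.lose u∈R (u≢v , ¬uv)))
  ... | yes p with (u , u∈R , q) ← List.find p with (v , v∈R , v≢u , ¬vu) ← List.find q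
    with rec (remove u R) (length-remove u∈R) {u ∷ []}
           (u , λ { (here refl) → ε , here refl ∷ [] })
           (∈-remove⁺ v∈R v≢u) (λ { (here (inj₁ v≡u)) → v≢u v≡u ; (here (inj₂ vu)) → ¬vu vu })
  ...   | y , y∈ , y-far , simp = y , proj₁ (∈-remove⁻ R y∈) ,
    λ a∈ b∈ ya yb → simp (∈-remove⁺ a∈ (not-u ya)) (∈-remove⁺ b∈ (not-u yb)) ya yb
    where
    not-u : ∀ {a} → Adj G y a → a ≢ u
    not-u ya refl = y-far (here (inj₂ ya))

  farSimplicial : ∀ fuel U → length U ℕ.≤ fuel → FarSimplicial U
  farSimplicial ℕ.zero [] _ _ ()
  farSimplicial (suc fuel) U U≤ {B} conn {x₀} x₀∈U x₀-far
    with any? (λ x → any? (λ y → ¬? (near? B x) ×-dec near? B y ×-dec ¬? (adj? x y)) U) U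
  -- A near `y` not adjacent to a far `x` moves from `U` to `B`. Then `x` remains far, and the
  -- vertex found is not adjacent to `y`, hence simplicial in all of `U`.
  ... | yes p with (x , x∈U , q) ← List.find p with (y , y∈U , x-far , y-near , ¬xy) ← List.find q
    with farSimplicial fuel (remove y U) (ℕ.s≤s⁻¹ (ℕ.<-≤-trans (length-remove y∈U) U≤))
           (ConnectedSet-∷ conn y-near) (∈-remove⁺ x∈U λ { refl → x-far y-near })
           (λ { (here (inj₁ refl)) → x-far y-near ; (here (inj₂ xy)) → ¬xy xy ; (there near) → x-far near })
  ...   | z , z∈ , z-far , simp = z , proj₁ (∈-remove⁻ U z∈) , (λ near → z-far (there near)) ,
    λ a∈ b∈ za zb → simp (∈-remove⁺ a∈ (not-y za)) (∈-remove⁺ b∈ (not-y zb)) za zb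
    where
    not-y : ∀ {a} → Adj G z a → a ≢ y
    not-y za refl = z-far (here (inj₂ za))
  -- Now each far vertex of `U` is adjacent to every near one. A far vertex simplicial among the far
  -- ones is simplicial in `U`: two near neighbours are adjacent by `near-neighbours-adjacent`, a
  -- mixed pair by completeness.
  farSimplicial (suc fuel) U U≤ {B} conn {x₀} x₀∈U x₀-far | no ¬p
    with simplicialIn R (λ V V< → farSimplicial fuel V
           (ℕ.s≤s⁻¹ (ℕ.<-≤-trans V< (ℕ.≤-trans (length-filter far? U) U≤))))
           (∈-filter⁺ far? x₀∈U x₀-far)
    where
    far? = λ x → ¬? (near? B x)
    R = filter far? U
  ... | y , y∈R , simp = let y∈U , y-far = ∈-filter⁻ far? {xs = U} y∈R in
    y , y∈U , y-far , λ {a} {b} → extend y-far {a} {b}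
    where
    far? = λ x → ¬? (near? B x)
    complete : ∀ {x y} → x List.∈ U → y List.∈ U → ¬ Near B x → Near B y → Adj G x y
    complete {x} {y} x∈U y∈U x-far y-near = decidable-stable (adj? x y) λ ¬xy →
      ¬p (List.lose x∈U (List.lose y∈U (x-far , y-near , ¬xy)))
    extend : ¬ Near B y → Simplicial U y
    extend y-far {a} {b} a∈ b∈ ya yb a≢b with near? B a | near? B b
    ... | yes na | yes nb = near-neighbours-adjacent conn y-far na nb ya yb a≢b
    ... | yes na | no ¬nb = adj-sym (complete b∈ a∈ ¬nb na)
    ... | no ¬na | yes nb = complete a∈ b∈ ¬na nb
    ... | no ¬na | no ¬nb = simp (∈-filter⁺ far? a∈ ¬na) (∈-filter⁺ far? b∈ ¬nb) ya yb a≢b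

  simplicial : ∀ U → x List.∈ U → ∃[ y ] y List.∈ U × Simplicial U y
  simplicial U = simplicialIn U (λ V _ → farSimplicial (length V) V ℕ.≤-refl)

-- Existence of a clique tree

-- The latest member comes first.  Members are incomparable, so a family covering
-- all cliques consists of the maximal ones.
data RIP {n : ℕ} : List (Subset n) → Set where
  single : ∀ {D} → RIP (D ∷ [])
  add    : ∀ {D P Ds} → P List.∈ Ds → (∀ {E} → E List.∈ Ds → E ∩ D ⊆ P) →
           (∀ {E} → E List.∈ Ds → ¬ E ⊆ D × ¬ D ⊆ E) → RIP Ds → RIP (D ∷ Ds)

module _ {n : ℕ} where
  private
    variable
      x : Fin n
      D E : Subset n
      Ds : List (Subset n)

  RIP-antichain : RIP Ds → D List.∈ Ds → E List.∈ Ds → D ⊆ E → D ≡ E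
  RIP-antichain single (here refl) (here refl) _ = refl
  RIP-antichain (add _ _ _ _) (here refl) (here refl) _ = refl
  RIP-antichain (add _ _ inc _) (here refl) (there E∈) D⊆E = ⊥-elim (proj₂ (inc E∈) D⊆E)
  RIP-antichain (add _ _ inc _) (there D∈) (here refl) D⊆E = ⊥-elim (proj₁ (inc D∈) D⊆E)
  RIP-antichain (add _ _ _ rip) (there D∈) (there E∈) D⊆E = RIP-antichain rip D∈ E∈ D⊆E

  enlarge : Fin n → Subset n → Subset n → Subset n
  enlarge x D E with ≡-dec Bool._≟_ E D
  ... | yes _ = E ∪ ⁅ x ⁆
  ... | no  _ = E

  ⊆-enlarge : ∀ {x} D E → E ⊆ enlarge x D E
  ⊆-enlarge D E y∈E with ≡-dec Bool._≟_ E D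
  ... | yes _ = x∈p∪q⁺ (inj₁ y∈E)
  ... | no  _ = y∈E

  ∈-enlarge⁺ : ∀ {x} D → x ∈ enlarge x D D
  ∈-enlarge⁺ {x} D with ≡-dec Bool._≟_ D D
  ... | yes _ = x∈p∪q⁺ (inj₂ (x∈⁅x⁆ x))
  ... | no ¬p = contradiction refl ¬p

  ∈-enlarge⁻ : ∀ {x y} D E → y ∈ enlarge x D E → y ∈ E ⊎ (y ≡ x × E ≡ D)
  ∈-enlarge⁻ {x} D E y∈ with ≡-dec Bool._≟_ E D
  ... | no  _ = inj₁ y∈
  ... | yes E≡D = Sum.map₂ (λ y∈ → x∈⁅y⁆⇒x≡y x y∈ , E≡D) (x∈p∪q⁻ E ⁅ x ⁆ y∈)

  -- Only the image of `D` receives `x`, and incomparability makes the members distinct, so `x`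
  -- enters no intersection of two of them. Inclusions between enlarged members restrict to the old
  -- ones since `x` is new.
  RIP-enlarge : RIP Ds → (∀ {E} → E List.∈ Ds → x ∉ E) → RIP (map (enlarge x D) Ds)
  RIP-enlarge single _ = single
  RIP-enlarge {x = x} {D = D} (add {D = F} {P} {Ds} P∈ rip inc rips) new =
    add (∈-map⁺ (enlarge x D) P∈) rip′ inc′ (RIP-enlarge rips (λ E∈ → new (there E∈)))
    where
    rip′ : ∀ {E} → E List.∈ map (enlarge x D) Ds → E ∩ enlarge x D F ⊆ enlarge x D P
    rip′ E′∈ y∈ with (E , E∈ , refl) ← ∈-map⁻ (enlarge x D) E′∈
      with y∈E , y∈F ← x∈p∩q⁻ _ _ y∈
      with ∈-enlarge⁻ D E y∈E | ∈-enlarge⁻ D F y∈F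
    ... | inj₁ y∈E         | inj₁ y∈F         = ⊆-enlarge D P (rip E∈ (x∈p∩q⁺ (y∈E , y∈F)))
    ... | inj₁ y∈E         | inj₂ (refl , _)  = contradiction y∈E (new (there E∈))
    ... | inj₂ (refl , _)  | inj₁ y∈F         = contradiction y∈F (new (here refl))
    ... | inj₂ (_ , refl)  | inj₂ (_ , refl)  = ⊥-elim (proj₁ (inc E∈) λ z∈ → z∈)
    restrict : ∀ {E F} → x ∉ E → enlarge x D E ⊆ enlarge x D F → E ⊆ F
    restrict {E} {F} x∉E sub z∈E with ∈-enlarge⁻ D F (sub (⊆-enlarge D E z∈E))
    ... | inj₁ z∈F        = z∈F
    ... | inj₂ (refl , _) = contradiction z∈E x∉E
    inc′ : ∀ {E} → E List.∈ map (enlarge x D) Ds → ¬ E ⊆ enlarge x D F × ¬ enlarge x D F ⊆ E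
    inc′ E′∈ with (E , E∈ , refl) ← ∈-map⁻ (enlarge x D) E′∈ =
      (λ sub → proj₁ (inc E∈) (restrict {E} {F} (new (there E∈)) sub)) ,
      (λ sub → proj₂ (inc E∈) (restrict {F} {E} (new (here refl)) sub))

comprehension : ∀ {n} {P : Fin n → Set} → (∀ x → Dec (P x)) →
                Σ[ S ∈ Subset n ] (∀ {x} → x ∈ S → P x) × (∀ {x} → P x → x ∈ S)
comprehension P? = tabulate (λ x → does (P? x)) ,
  (λ {x} x∈ → from x (trans (sym (lookup∘tabulate (λ x → does (P? x)) x)) ([]=⇒lookup x∈))) ,
  (λ {x} px → lookup⇒[]= x _ (trans (lookup∘tabulate (λ x → does (P? x)) x) (dec-true (P? x) px)))
  where
  from : ∀ x → does (P? x) ≡ true → _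
  from x eq with yes p ← P? x = p

module Existence {n : ℕ} (G : Graph n) (chordal : Chordal G) where
  open Dirac G chordal
  open Graph G using (adj?) renaming (sym to adj-sym)

  record CliqueFamily (U : List (Fin n)) : Set where
    field
      family : List (Subset n)
      rip    : RIP family
      clique : ∀ {D} → D List.∈ family → IsClique G D
      within : ∀ {D} → D List.∈ family → ∀ {x} → x ∈ D → x List.∈ U
      covers : ∀ {Q} → IsClique G Q → (∀ {x} → x ∈ Q → x List.∈ U) →
               ∃[ D ] D List.∈ family × Q ⊆ D

  clique-∪ : ∀ {x D} → IsClique G D → (∀ {y} → y ∈ D → Adj G x y) → IsClique G (D ∪ ⁅ x ⁆)
  clique-∪ {x} {D} D-clique x-adj u∈ v∈ u≢v with x∈p∪q⁻ D ⁅ x ⁆ u∈ | x∈p∪q⁻ D ⁅ x ⁆ v∈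
  ... | inj₁ u∈D | inj₁ v∈D = D-clique u∈D v∈D u≢v
  ... | inj₁ u∈D | inj₂ v∈x with refl ← x∈⁅y⁆⇒x≡y x v∈x = adj-sym (x-adj u∈D)
  ... | inj₂ u∈x | inj₁ v∈D with refl ← x∈⁅y⁆⇒x≡y x u∈x = x-adj v∈D
  ... | inj₂ u∈x | inj₂ v∈x =
    contradiction (trans (x∈⁅y⁆⇒x≡y x u∈x) (sym (x∈⁅y⁆⇒x≡y x v∈x))) u≢v

  -- The neighbours `N` of `x` within `U` form a clique, contained in a member `D`. If `D` equals
  -- `N`, it is enlarged by `x`; if not, `N ∪ ⁅ x ⁆` becomes the latest member, and it meets the
  -- others within `N ⊆ D`.
  addSimplicial : ∀ {U x} → x List.∈ U → Simplicial U x → CliqueFamily (remove x U) → CliqueFamily U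
  addSimplicial {U} {x} x∈U simp F
    with comprehension (λ y → adj? x y ×-dec any? (y ≟_) (remove x U))
  ... | N , N⁻ , N⁺ with CliqueFamily.covers F N-clique (λ y∈N → proj₂ (N⁻ y∈N))
    where
    N-clique : IsClique G N
    N-clique u∈N v∈N = let xu , u∈ = N⁻ u∈N ; xv , v∈ = N⁻ v∈N in
      simp (proj₁ (∈-remove⁻ U u∈)) (proj₁ (∈-remove⁻ U v∈)) xu xv
  ...   | D , D∈ , N⊆D = result (D ⊆? N)
    where
    open CliqueFamily F
    N-clique : IsClique G N
    N-clique u∈N v∈N = clique D∈ (N⊆D u∈N) (N⊆D v∈N)
    new : ∀ {E} → E List.∈ family → x ∉ E
    new E∈ x∈E = proj₂ (∈-remove⁻ U (within E∈ x∈E)) refl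
    old : ∀ {E} → E List.∈ family → ∀ {y} → y ∈ E → y List.∈ U
    old E∈ y∈E = proj₁ (∈-remove⁻ U (within E∈ y∈E))
    neighbours : ∀ {Q} → IsClique G Q → (∀ {y} → y ∈ Q → y List.∈ U) → x ∈ Q →
                 ∀ {y} → y ∈ Q → y ∈ N ⊎ y ≡ x
    neighbours Q-clique Q⊆U x∈Q {y} y∈Q with y ≟ x
    ... | yes y≡x = inj₂ y≡x
    ... | no  y≢x = inj₁ (N⁺ (Q-clique x∈Q y∈Q (λ x≡y → y≢x (sym x≡y)) , ∈-remove⁺ (Q⊆U y∈Q) y≢x))
    avoids : ∀ {Q} → (∀ {y} → y ∈ Q → y List.∈ U) → x ∉ Q → ∀ {y} → y ∈ Q → y List.∈ remove x U
    avoids Q⊆U x∉Q y∈Q = ∈-remove⁺ (Q⊆U y∈Q) λ { refl → x∉Q y∈Q }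

    result : Dec (D ⊆ N) → CliqueFamily U
    result (yes D⊆N) = record
      { family = map (enlarge x D) family
      ; rip    = RIP-enlarge rip new
      ; clique = clique′
      ; within = within′
      ; covers = covers′
      }
      where
      clique′ : ∀ {E} → E List.∈ map (enlarge x D) family → IsClique G E
      clique′ E′∈ with E , E∈ , refl ← ∈-map⁻ (enlarge x D) E′∈ with ≡-dec Bool._≟_ E D
      ... | no  _    = clique E∈
      ... | yes refl = clique-∪ (clique E∈) (λ y∈D → proj₁ (N⁻ (D⊆N y∈D)))
      within′ : ∀ {E} → E List.∈ map (enlarge x D) family → ∀ {y} → y ∈ E → y List.∈ U
      within′ E′∈ y∈ with E , E∈ , refl ← ∈-map⁻ (enlarge x D) E′∈ with ∈-enlarge⁻ D E y∈
      ... | inj₁ y∈E        = old E∈ y∈E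
      ... | inj₂ (refl , _) = x∈U
      covers′ : ∀ {Q} → IsClique G Q → (∀ {y} → y ∈ Q → y List.∈ U) →
                ∃[ E ] E List.∈ map (enlarge x D) family × Q ⊆ E
      covers′ {Q} Q-clique Q⊆U with x ∈? Q
      ... | yes x∈Q = enlarge x D D , ∈-map⁺ (enlarge x D) D∈ , λ y∈Q →
        Sum.[ (λ y∈N → ⊆-enlarge D D (N⊆D y∈N)) , (λ { refl → ∈-enlarge⁺ D }) ]
          (neighbours Q-clique Q⊆U x∈Q y∈Q)
      ... | no x∉Q with covers Q-clique (avoids Q⊆U x∉Q)
      ...   | E , E∈ , Q⊆E = enlarge x D E , ∈-map⁺ (enlarge x D) E∈ , λ y∈Q → ⊆-enlarge D E (Q⊆E y∈Q)
    result (no D⊈N) = record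
      { family = N ∪ ⁅ x ⁆ ∷ family
      ; rip    = add D∈ meet inc rip
      ; clique = λ { (here refl) → clique-∪ N-clique (λ y∈N → proj₁ (N⁻ y∈N)) ; (there E∈) → clique E∈ }
      ; within = λ { (here refl) y∈ → within′ y∈ ; (there E∈) → old E∈ }
      ; covers = covers′
      }
      where
      split : ∀ {y} → y ∈ N ∪ ⁅ x ⁆ → y ∈ N ⊎ y ≡ x
      split y∈ = Sum.map₂ (x∈⁅y⁆⇒x≡y x) (x∈p∪q⁻ N ⁅ x ⁆ y∈)
      old⊆N : ∀ {E} → E List.∈ family → ∀ {y} → y ∈ E → y ∈ N ∪ ⁅ x ⁆ → y ∈ N
      old⊆N E∈ y∈E y∈ with split y∈
      ... | inj₁ y∈N  = y∈N
      ... | inj₂ refl = contradiction y∈E (new E∈)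
      meet : ∀ {E} → E List.∈ family → E ∩ (N ∪ ⁅ x ⁆) ⊆ D
      meet E∈ y∈ = let y∈E , y∈X = x∈p∩q⁻ _ _ y∈ in N⊆D (old⊆N E∈ y∈E y∈X)
      inc : ∀ {E} → E List.∈ family → ¬ E ⊆ N ∪ ⁅ x ⁆ × ¬ N ∪ ⁅ x ⁆ ⊆ E
      -- A member `E` inside `N ∪ ⁅ x ⁆` would lie in `N`, hence in `D`; so `E` is `D`, and `D ⊆ N`.
      inc {E} E∈ = (λ E⊆X → D⊈N (subst (_⊆ N) (RIP-antichain rip E∈ D∈ (λ y∈E → N⊆D (old⊆N E∈ y∈E (E⊆X y∈E))))
                                  (λ y∈E → old⊆N E∈ y∈E (E⊆X y∈E)))) ,
                   (λ X⊆E → new E∈ (X⊆E (x∈p∪q⁺ (inj₂ (x∈⁅x⁆ x)))))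
      within′ : ∀ {y} → y ∈ N ∪ ⁅ x ⁆ → y List.∈ U
      within′ y∈ with split y∈
      ... | inj₁ y∈N  = proj₁ (∈-remove⁻ U (proj₂ (N⁻ y∈N)))
      ... | inj₂ refl = x∈U
      covers′ : ∀ {Q} → IsClique G Q → (∀ {y} → y ∈ Q → y List.∈ U) →
                ∃[ E ] E List.∈ (N ∪ ⁅ x ⁆ ∷ family) × Q ⊆ E
      covers′ {Q} Q-clique Q⊆U with x ∈? Q
      ... | yes x∈Q = N ∪ ⁅ x ⁆ , here refl , λ y∈Q →
        x∈p∪q⁺ (Sum.map₂ (λ { refl → x∈⁅x⁆ x }) (neighbours Q-clique Q⊆U x∈Q y∈Q))
      ... | no x∉Q with covers Q-clique (avoids Q⊆U x∉Q)
      ...   | E , E∈ , Q⊆E = E , there E∈ , Q⊆E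

  cliqueFamily : ∀ fuel U → length U ℕ.≤ fuel → CliqueFamily U
  cliqueFamily _ [] _ = record
    -- The empty clique makes the family nonempty, as `RIP` requires; the first simplicial vertex
    -- enlarges it.
    { family = ∅ ∷ []
    ; rip    = single
    ; clique = λ { (here refl) u∈ → contradiction u∈ ∉⊥ }
    ; within = λ { (here refl) u∈ → contradiction u∈ ∉⊥ }
    ; covers = λ _ Q⊆[] → ∅ , here refl , λ x∈Q → contradiction (Q⊆[] x∈Q) λ ()
    }
  cliqueFamily (suc fuel) U@(_ ∷ _) U≤ =
    let x , x∈U , simp = simplicial U (here refl) in
    addSimplicial x∈U simp (cliqueFamily fuel (remove x U) (ℕ.s≤s⁻¹ (ℕ.<-≤-trans (length-remove x∈U) U≤)))

  -- From the clique family to a clique tree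

  module _ (𝒞 : MaximalCliques G) where
    open MaximalCliques 𝒞

    Joined : Fin K → List (Fin K) → Set
    Joined v L = ∃[ p ] p List.∈ L × (∀ {u} → u List.∈ L → C u ∩ C v ⊆ C p)

    record Indices (Ds : List (Subset n)) : Set where
      field
        {root}  : Fin K
        {order} : List (Fin K)
        build   : Build Joined root order
        sound   : ∀ {u} → u List.∈ order → C u List.∈ Ds
        full    : ∀ {D} → D List.∈ Ds → ∃[ u ] u List.∈ order × C u ≡ D

    indices : ∀ {Ds} → RIP Ds → (∀ {D} → D List.∈ Ds → IsMaximalClique G D) → Indices Ds
    indices (single {D}) max with i , refl ← complete D (max (here refl)) = record
      { build = initial
      ; sound = λ { (here refl) → here refl }
      ; full  = λ { (here refl) → i , here refl , refl }
      }
    indices (add {D} P∈ meet inc rip) max with i , refl ← complete D (max (here refl)) =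
      let p , p∈ , Cp≡P = full P∈ in record
      { build = add (λ i∈ → proj₁ (inc (sound i∈)) (λ z∈ → z∈))
                    (p , p∈ , λ u∈ → subst (_ ⊆_) (sym Cp≡P) (meet (sound u∈))) build
      ; sound = λ { (here refl) → here refl ; (there u∈) → there (sound u∈) }
      ; full  = λ { (here refl) → i , here refl , refl
                  ; (there D∈) → let u , u∈ , q = full D∈ in u , there u∈ , q }
      }
      where open Indices (indices rip (λ D∈ → max (there D∈)))

    orderingTree : ∀ {r} → Ordering Joined r → CliqueTree 𝒞
    orderingTree {r} ord = Generated.cliqueTree 𝒞 π (proj₁ parents) (proj₂ parents) r
      where
      open Ordering ord renaming (perm to π)
      parents : Σ[ choice ∈ (Fin K → Fin K) ] IsChoice 𝒞 π choice
      parents = pickParents (λ k l → l Fin.< k × separator 𝒞 π k ≡ C (π ⟨$⟩ʳ l) ∩ C (π ⟨$⟩ʳ k))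
        λ k 0<k →
          let E , (p , p∈E , meet) , to , from = ok k 0<k
              l , l<k , πl≡p = from p∈E
          in l , l<k , separator-parent 𝒞 π l<k λ v∈ →
               let (j , j<k , v∈j) , v∈k = ∈-separator⁻ 𝒞 π v∈ in
               subst (λ q → _ ∈ C q) (sym πl≡p) (meet (to j<k) (x∈p∩q⁺ (v∈j , v∈k)))

    cliqueTree-exists : CliqueTree 𝒞
    cliqueTree-exists = orderingTree (ordering build all∈)
      where
      open CliqueFamily (cliqueFamily n (allFin n) (ℕ.≤-reflexive (length-tabulate (λ x → x))))
      covers′ : ∀ {Q} → IsClique G Q → ∃[ D ] D List.∈ family × Q ⊆ D
      covers′ Q-clique = covers Q-clique (λ {x} _ → ∈-allFin x)
      -- A clique `S` containing `D` lies in a member `E`, and incomparability forces `D ≡ E`.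
      max : ∀ {D} → D List.∈ family → IsMaximalClique G D
      max D∈ = clique D∈ , λ S S-clique D⊆S → let E , E∈ , S⊆E = covers′ S-clique in
        subst (S ⊆_) (sym (RIP-antichain rip D∈ E∈ (λ y∈D → S⊆E (D⊆S y∈D)))) S⊆E
      open Indices (indices rip max)
      all∈ : ∀ i → i List.∈ order
      all∈ i = let D , D∈ , Ci⊆D = covers′ (proj₁ (maximal i))
                   u , u∈ , Cu≡D = full D∈
               in subst (List._∈ order) (injective (trans Cu≡D
                    (⊆-antisym (proj₂ (maximal i) D (clique D∈) Ci⊆D) Ci⊆D))) u∈

theorem4p1 : ∀ {n : ℕ} (G : Graph n) → Connected (Adj G) → Chordal G →
    (𝒞 : MaximalCliques G) → Connected (BipartiteAdj 𝒞)
theorem4p1 G _ chordal 𝒞 = bipartite-connected 𝒞 (Existence.cliqueTree-exists G chordal 𝒞)
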